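{- $V_c(g) = \sqrt{6g} + o(\sqrt g)$ as $g \to +\infty$.
   Context: Graphs are finite and connected, loops and multiple edges allowed. $S$ = number of vertices. A graph embedded in an oriented surface inherits a polarization: at each vertex, oriented edges based there are cyclically ordered counterclockwise; this defines a permutation $\tau$ of oriented edges, $\tau(o,p)=(p,q)$ where $(p,q)$ immediately follows $(p,o)$ in the cyclic order at $p$. Orbits of $\tau$ are left walks; a left walk is complete if it traverses every unoriented edge at least once. An embedding $G\subset\Sigma$ is cellular if $\Sigma\setminus G$ is a disjoint union of open 2-cells; $\Sigma_g$ is the closed oriented surface of genus $g$. A reduced subgraph of $G$ has the same vertices, no loops, and exactly one edge of $G$ between any two distinct vertices joined in $G$; with $A_r(G)$ its number of edges, the reduced average valence is $V_r(G)=2A_r(G)/S$. $V_c(g)$ is the supremum of $V_r(G)$ over graphs cellularly embedded in $\Sigma_g$ having a complete left walk for the induced polarization. -}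

module Defs where

open import Data.Nat using (ℕ; zero; suc; _+_; _*_; _≤_; _<_)
open import Data.Fin using (Fin; toℕ)
open import Data.Fin.Permutation using (Permutation′; _⟨$⟩ʳ_)
open import Data.Product using (Σ; ∃; _×_; _,_)
open import Data.Sum using (_⊎_)
open import Function using (_∘_)
open import Function.Bundles using (_⇔_)
open import Function.Definitions using (Injective)
open import Relation.Binary.PropositionalEquality using (_≡_; _≢_)
open import Relation.Binary.Construct.Closure.ReflexiveTransitive using (Star)

iter : {A : Set} → (A → A) → ℕ → A → A
iter f zero x = x
iter f (suc k) x = f (iter f k x)

-- y lies in the forward orbit of x under f (for permutations: same orbit)
SameOrbit : {A : Set} → (A → A) → A → A → Set
SameOrbit f x y = ∃ λ k → iter f k x ≡ y

-- x is the smallest element (by index) of its f-orbit: canonical orbit representatives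
OrbitMin : {n : ℕ} → (Fin n → Fin n) → Fin n → Set
OrbitMin f x = ∀ y → SameOrbit f x y → toℕ x ≤ toℕ y

Card : {A : Set} → (A → Set) → ℕ → Set
Card {A} P k = Σ (Fin k → A) λ e → Injective _≡_ _≡_ e × (∀ a → P a ⇔ ∃ λ i → e i ≡ a)

-- A connected graph with an embedding in an oriented surface, encoded combinatorially
-- (rotation system / combinatorial map).  Darts = oriented edges (Fin darts).
-- α reverses a dart: α (o,p) = (p,o).  A dart is based at its origin.
-- σ is the counterclockwise cyclic order of darts around each vertex;
-- vertices = σ-orbits, unoriented edges = α-orbits.
record Map : Set where
  field
    darts : ℕ
    σ : Permutation′ darts
    α : Fin darts → Fin darts
    α-invol : ∀ d → α (α d) ≡ d
    α-free : ∀ d → α d ≢ d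
    connected : ∀ x y → Star (λ a b → b ≡ σ ⟨$⟩ʳ a ⊎ b ≡ α a) x y

  rot : Fin darts → Fin darts
  rot d = σ ⟨$⟩ʳ d

  -- the induced polarization: τ(o,p) = (p,q), the dart following (p,o) at p
  τ : Fin darts → Fin darts
  τ = rot ∘ α

  NumVertices : ℕ → Set
  NumVertices S = Card (OrbitMin rot) S

  -- number of faces = number of left walks (orbits of τ)
  NumFaces : ℕ → Set
  NumFaces F = Card (OrbitMin τ) F

  -- the combinatorial map is the cellular embedding in Σ_g (Euler: S - E + F = 2 - 2g)
  CellularGenus : ℕ → Set
  CellularGenus g = ∃ λ S → ∃ λ F → ∃ λ E →
    (darts ≡ E + E) × NumVertices S × NumFaces F × (S + F + 2 * g ≡ 2 + E)

  HasCompleteLeftWalk : Set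
  HasCompleteLeftWalk = ∃ λ d₀ → ∀ d → SameOrbit τ d₀ d ⊎ SameOrbit τ d₀ (α d)

  -- unordered pairs of distinct vertices joined by an edge, each vertex represented by
  -- the least dart of its σ-orbit; their number is A_r(G)
  JoinedPair : Fin darts × Fin darts → Set
  JoinedPair (x , y) = OrbitMin rot x × OrbitMin rot y × toℕ x < toℕ y
    × ∃ λ d → SameOrbit rot x d × SameOrbit rot y (α d)

  ReducedEdges : ℕ → Set
  ReducedEdges A = Card JoinedPair A

{-# OPTIONS --safe #-}

-- Upper bound.  Every edge has a side on the complete left walk, so the remaining F - 1 faces have
-- disjoint sets of edges; charging each of them to its edges gives 3 (E + 1) ≥ 3 F + 2 A.  By Euler's
-- formula 2 A ≤ 3 S + 6 g, and trivially 2 A ≤ S², hence 2 A / S is at most about √(6 g).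
--
-- Lower bound.  Given a map in which one face passes every edge, glue a triangle to three corners of
-- that face at distinct vertices.  One of the two orientations of the triangle keeps the rest of the
-- face in one piece, and then the genus grows by one.  Starting from a plane tree with S vertices, g
-- triangles give a map of genus g with a complete left walk, whatever the triples of vertices.  A
-- nearly complete set of about S² / 6 triples (after Bose) joins almost all pairs of vertices, so
-- S ~ √(6 g) is attained.
module Submission where

open import Defs
open import Data.Nat using (ℕ; zero; suc; _+_; _*_; _^_; _∸_; _≤_; _<_; z≤n; s≤s)
open import Data.Nat.DivMod using (_%_; _/_; m%n<n; m≡m%n+[m/n]*n; m%n%n≡m%n; %-distribˡ-+; [m+n]%n≡m%n; m<n⇒m%n≡m)
import Data.Nat.Properties as ℕₚ
open import Data.Nat.Tactic.RingSolver using (solve-∀)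
open import Data.Fin using (Fin; zero; suc; toℕ; fromℕ<; punchIn; combine; _↑ʳ_)
open import Data.Fin.Patterns using (0F; 1F; 2F; 3F; 4F; 5F)
open import Data.Fin.Permutation using (permutation)
open import Data.Fin.Properties using (_≟_; any?; all?; pigeonhole; injective⇒≤; toℕ-injective; toℕ-fromℕ<; toℕ<n;
  +↔⊎; *↔×; suc-injective; punchIn-injective; punchInᵢ≢i; ↑ʳ-injective; combine-injectiveˡ; combine-injectiveʳ)
open import Data.List using (List; []; _∷_; _++_; map; [_]; length; replicate; allFin; cartesianProductWith)
open import Data.List.Properties using (map-++; ++-assoc; length-++; length-map; length-replicate; length-tabulate)
open import Data.List.Membership.Propositional using (_∈_)
open import Data.List.Membership.Propositional.Properties using (∈-map⁺; ∈-map⁻; ∈-++⁺ˡ; ∈-++⁺ʳ; ∈-++⁻; ∈-∃++; ∈-insert;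
  ∈-allFin; ∈-cartesianProductWith⁺)
open import Data.List.Relation.Unary.Any using (here; there)
open import Data.List.Relation.Unary.All as All using (All; []; _∷_)
import Data.List.Relation.Unary.All.Properties as Allₚ
open import Data.List.Relation.Unary.AllPairs using ([]; _∷_)
open import Data.List.Relation.Unary.Unique.Propositional using (Unique)
import Data.List.Relation.Unary.Unique.Propositional.Properties as Uniqueₚ
open import Data.List.Relation.Binary.Permutation.Propositional using (_↭_; ↭⇒↭ₛ; ↭-sym; ↭-trans; prep; ↭-reflexive;
  module PermutationReasoning)
open import Data.List.Relation.Binary.Permutation.Propositional.Properties using (∈-resp-↭; shift; shifts; ++⁺ˡ)
import Data.List.Relation.Binary.Permutation.Setoid.Properties as SetoidPermₚ
open import Data.Product using (∃; _×_; _,_; _,′_; proj₁; proj₂; uncurry)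
open import Data.Product.Function.NonDependent.Propositional using (_×-↔_)
open import Data.Sum as Sum using (_⊎_; inj₁; inj₂)
open import Data.Sum.Function.Propositional using (_⊎-↔_)
open import Data.Sum.Properties using (inj₁-injective)
open import Data.Empty using (⊥; ⊥-elim)
open import Function using (_∘_; id)
open import Function.Bundles using (_↔_; mk⇔; Equivalence; Inverse; Injection)
open import Function.Construct.Composition using (_↔-∘_)
open import Function.Construct.Identity using (↔-id)
open import Function.Construct.Symmetry using (↔-sym)
open import Function.Definitions using (Injective)
open import Function.Properties.Inverse using (↔⇒↣)
open import Relation.Nullary using (¬_; Dec; yes; no)
open import Relation.Nullary.Decidable using (_×-dec_; _→-dec_; _⊎-dec_; map′)
open import Relation.Unary using (Decidable)
open import Relation.Binary.Construct.Closure.ReflexiveTransitive using (Star; ε; _◅_; _◅◅_)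
open import Relation.Binary.Definitions using (tri<; tri≈; tri>)
open import Relation.Binary.PropositionalEquality hiding ([_])

-- Orbits

-- The two upper bounds on `2A` cross near `S² = 6g`. A sharp example must therefore join almost all
-- of the S²/2 pairs of vertices and have triangles for almost all of its inner faces, since a
-- longer face leaves tokens unspent. A glued triangle costs one unit of genus and brings three
-- edges, whence g ~ S²/6. Every vertex stays on the outer walk, so the embedding puts no condition
-- on the triples: what remains is to cover pairs by triples economically, a question about designs.
-- As multiple edges are allowed, spare triangles can raise the genus to any prescribed value
-- without losing a joined pair. Vertices and faces are counted by the least darts of their orbits,
-- which every insertion reshuffles. The construction therefore carries explicit labellings of
-- vertices and faces, and returns to least darts only at the end.

iter-+ : {A : Set} (f : A → A) (a b : ℕ) (x : A) → iter f (a + b) x ≡ iter f a (iter f b x)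
iter-+ f zero b x = refl
iter-+ f (suc a) b x = cong f (iter-+ f a b x)

iter-cong : {A : Set} {f g : A → A} → (∀ x → f x ≡ g x) → ∀ k x → iter f k x ≡ iter g k x
iter-cong eq zero x = refl
iter-cong {f = f} eq (suc k) x = trans (cong f (iter-cong eq k x)) (eq _)

iter-fixed : {A : Set} (f : A → A) (k m : ℕ) {x : A} → iter f k x ≡ x → iter f (m * k) x ≡ x
iter-fixed f k zero eq = refl
iter-fixed f k (suc m) {x} eq =
  trans (iter-+ f k (m * k) x) (trans (cong (iter f k) (iter-fixed f k m eq)) eq)

iter-injective : {A : Set} {f : A → A} → Injective _≡_ _≡_ f → ∀ k → Injective _≡_ _≡_ (iter f k)
iter-injective inj zero eq = eq
iter-injective inj (suc k) eq = iter-injective inj k (inj eq)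

orbit-refl : {A : Set} {f : A → A} {x : A} → SameOrbit f x x
orbit-refl = 0 , refl

orbit-step : {A : Set} {f : A → A} {x : A} → SameOrbit f x (f x)
orbit-step = 1 , refl

orbit-trans : {A : Set} {f : A → A} {x y z : A} → SameOrbit f x y → SameOrbit f y z → SameOrbit f x z
orbit-trans {f = f} {x} (a , p) (b , q) =
  b + a , trans (iter-+ f b a x) (trans (cong (iter f b) p) q)

orbit-≗ : {A : Set} {f g : A → A} → (∀ x → f x ≡ g x) → ∀ {x y} → SameOrbit f x y → SameOrbit g x y
orbit-≗ eq {x} (k , p) = k , trans (sym (iter-cong eq k x)) p

orbit-invariant : {A B : Set} {f : A → A} (ℓ : A → B) → (∀ x → ℓ (f x) ≡ ℓ x) →
  ∀ {x y} → SameOrbit f x y → ℓ x ≡ ℓ y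
orbit-invariant {A} {f = f} ℓ inv (k , p) = trans (sym (go k _)) (cong ℓ p)
  where
  go : ∀ k (x : A) → ℓ (iter f k x) ≡ ℓ x
  go zero x = refl
  go (suc k) x = trans (inv _) (go k x)

module _ {n : ℕ} {f : Fin n → Fin n} (inj : Injective _≡_ _≡_ f) where

  period : ∀ x → ∃ λ p → iter f (suc p) x ≡ x
  period x with pigeonhole (ℕₚ.n<1+n n) (λ k → iter f (toℕ k) x)
  ... | i , j , i<j , eq with ℕₚ.m≤n⇒∃[o]m+o≡n i<j
  ... | p , refl-eq = p , iter-injective inj (toℕ i) (trans (sym (iter-+ f (toℕ i) (suc p) x))
    (trans (cong (λ m → iter f m x) (trans (ℕₚ.+-suc (toℕ i) p) refl-eq)) (sym eq)))

  orbit-sym : ∀ {x y} → SameOrbit f x y → SameOrbit f y x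
  orbit-sym {x} (k , refl) with period x
  -- Since `suc p` is a period of `x`, each of the `k` steps is undone by `p` further ones.
  ... | p , eq = k * p ,
    trans (sym (iter-+ f (k * p) k x))
      (trans (cong (λ m → iter f m x) (trans (ℕₚ.+-comm (k * p) k) (sym (ℕₚ.*-suc k p))))
        (iter-fixed f (suc p) k eq))

  -- Reducing the exponent modulo a period leaves finitely many iterates to search.
  orbit? : ∀ x y → Dec (SameOrbit f x y)
  orbit? x y with period x
  ... | p , eq = map′ (λ (k , q) → toℕ k , q) bounded (any? (λ (k : Fin (suc p)) → iter f (toℕ k) x ≟ y))
    where
    bounded : SameOrbit f x y → ∃ λ (k : Fin (suc p)) → iter f (toℕ k) x ≡ y
    bounded (k , q) = fromℕ< (m%n<n k (suc p)) , (begin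
      iter f (toℕ (fromℕ< (m%n<n k (suc p)))) x   ≡⟨ cong (λ m → iter f m x) (toℕ-fromℕ< (m%n<n k (suc p))) ⟩
      iter f (k % suc p) x                        ≡⟨ cong (iter f (k % suc p)) (iter-fixed f (suc p) (k / suc p) eq) ⟨
      iter f (k % suc p) (iter f (k / suc p * suc p) x) ≡⟨ iter-+ f (k % suc p) _ x ⟨
      iter f (k % suc p + k / suc p * suc p) x    ≡⟨ cong (λ m → iter f m x) (m≡m%n+[m/n]*n k (suc p)) ⟨
      iter f k x                                  ≡⟨ q ⟩
      y ∎)
      where open ≡-Reasoning

  orbitMin? : Decidable (OrbitMin f)
  orbitMin? x = all? (λ y → orbit? x y →-dec (toℕ x ℕₚ.≤? toℕ y))

  orbitMin-unique : ∀ {x y} → OrbitMin f x → OrbitMin f y → SameOrbit f x y → x ≡ y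
  orbitMin-unique mx my o = toℕ-injective (ℕₚ.≤-antisym (mx _ o) (my _ (orbit-sym o)))

  orbitMin-common : ∀ {x y z} → OrbitMin f x → OrbitMin f y → SameOrbit f x z → SameOrbit f y z → x ≡ y
  orbitMin-common mx my o o' = orbitMin-unique mx my (orbit-trans o (orbit-sym o'))

rightInverse-injective : {A : Set} {f g : A → A} → (∀ x → f (g x) ≡ x) → Injective _≡_ _≡_ g
rightInverse-injective {f = f} fg {x} {y} eq = trans (sym (fg x)) (trans (cong f eq) (fg y))

-- A right inverse g of f is injective, so every g-orbit is a cycle and g also undoes f.
rightInverse⇒leftInverse : ∀ {n} {f g : Fin n → Fin n} → (∀ x → f (g x) ≡ x) → ∀ x → g (f x) ≡ x
rightInverse⇒leftInverse {f = f} {g} fg x with period (rightInverse-injective {f = f} fg) x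
... | p , eq = trans (cong (g ∘ f) (sym eq)) (trans (cong g (fg (iter g p x))) eq)

-- Counting

least : ∀ {n} {P : Fin n → Set} → Decidable P → ∃ P → ∃ λ i → P i × (∀ j → P j → toℕ i ≤ toℕ j)
least {suc n} P? w with P? zero
... | yes p = zero , p , λ _ _ → z≤n
least {suc n} P? (zero , p) | no ¬p = ⊥-elim (¬p p)
least {suc n} P? (suc i , p) | no ¬p with least (P? ∘ suc) (i , p)
... | j , q , min = suc j , q , λ where
  zero r → ⊥-elim (¬p r)
  (suc k) r → s≤s (min k r)

↔-injective : {A B : Set} (b : A ↔ B) → Injective _≡_ _≡_ (Inverse.to b)
↔-injective b = Injection.injective (↔⇒↣ b)

≤-from-injection : {A B : Set} {m n : ℕ} → Fin m ↔ A → Fin n ↔ B → (f : A → B) → Injective _≡_ _≡_ f → m ≤ n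
≤-from-injection a b f inj = injective⇒≤ {f = Inverse.from b ∘ f ∘ Inverse.to a}
  (λ eq → ↔-injective a (inj (↔-injective (↔-sym b) eq)))

fin⊎ : {A B : Set} {m n : ℕ} → Fin m ↔ A → Fin n ↔ B → Fin (m + n) ↔ (A ⊎ B)
fin⊎ a b = (a ⊎-↔ b) ↔-∘ +↔⊎

fin× : {A B : Set} {m n : ℕ} → Fin m ↔ A → Fin n ↔ B → Fin (m * n) ↔ (A × B)
fin× a b = (a ×-↔ b) ↔-∘ *↔×

module CardOf {A : Set} {P : A → Set} {k : ℕ} (c : Card P k) where

  elem : Fin k → A
  elem = proj₁ c

  elem-injective : Injective _≡_ _≡_ elem
  elem-injective = proj₁ (proj₂ c)

  elem-sat : ∀ i → P (elem i)
  elem-sat i = Equivalence.from (proj₂ (proj₂ c) (elem i)) (i , refl)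

  index : ∀ {a} → P a → Fin k
  index p = proj₁ (Equivalence.to (proj₂ (proj₂ c) _) p)

  elem-index : ∀ {a} (p : P a) → elem (index p) ≡ a
  elem-index p = proj₂ (Equivalence.to (proj₂ (proj₂ c) _) p)

  index-injective : ∀ {a b} (p : P a) (q : P b) → index p ≡ index q → a ≡ b
  index-injective p q eq = trans (sym (elem-index p)) (trans (cong elem eq) (elem-index q))

card-≤ : {A : Set} {P : A → Set} {k l : ℕ} → Card P k → Card P l → k ≤ l
card-≤ c d = injective⇒≤ {f = λ i → CardOf.index d (CardOf.elem-sat c i)}
  (λ eq → CardOf.elem-injective c (CardOf.index-injective d _ _ eq))

card-unique : {A : Set} {P : A → Set} {k l : ℕ} → Card P k → Card P l → k ≡ l
card-unique c d = ℕₚ.≤-antisym (card-≤ c d) (card-≤ d c)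

card-Fin : ∀ {n} {P : Fin n → Set} → Decidable P → ∃ (Card P)
card-Fin {zero} P? = 0 , (λ ()) , (λ { {()} }) , λ ()
card-Fin {suc n} {P} P? with card-Fin (P? ∘ suc) | P? zero
... | k , c | no ¬p = k , suc ∘ elem , elem-injective ∘ suc-injective , λ where
    zero → mk⇔ (λ p → ⊥-elim (¬p p)) (λ ())
    (suc a) → mk⇔ (λ p → index p , cong suc (elem-index p)) (λ where (i , refl) → elem-sat i)
  where open CardOf c
... | k , c | yes p = suc k , e , e-injective , λ where
    zero → mk⇔ (λ _ → zero , refl) (λ _ → p)
    (suc a) → mk⇔ (λ p → suc (index p) , cong suc (elem-index p)) (λ where (suc i , refl) → elem-sat i)
  where
  open CardOf c
  e : Fin (suc k) → Fin (suc n)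
  e zero = zero
  e (suc i) = suc (elem i)
  e-injective : Injective _≡_ _≡_ e
  e-injective {zero} {zero} _ = refl
  e-injective {suc i} {suc j} eq = cong suc (elem-injective (suc-injective eq))

card-↔ : {A B : Set} {P : B → Set} {k : ℕ} (b : A ↔ B) → Card (P ∘ Inverse.to b) k → Card P k
card-↔ {P = P} b c = to ∘ elem , elem-injective ∘ ↔-injective b , λ a → mk⇔
    (λ p → let q = subst P (sym (strictlyInverseˡ a)) p in
      index q , trans (cong to (elem-index q)) (strictlyInverseˡ a))
    (λ where (i , refl) → elem-sat i)
  where
  open CardOf c
  open Inverse b using (to; strictlyInverseˡ)

card-Fin² : ∀ {n} {P : Fin n × Fin n → Set} → Decidable P → ∃ (Card P)
card-Fin² P? with card-Fin (P? ∘ Inverse.to *↔×)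
... | k , c = k , card-↔ *↔× c

-- A surjective labelling whose fibres are the orbits counts them: the least dart with a given label
-- is the canonical representative of its orbit.
module OrbitLabels {n m : ℕ} {f : Fin n → Fin n} (inj : Injective _≡_ _≡_ f) (ℓ : Fin n → Fin m)
  (ℓ-invariant : ∀ x → ℓ (f x) ≡ ℓ x) (ℓ-orbit : ∀ x y → ℓ x ≡ ℓ y → SameOrbit f x y)
  (ℓ-surjective : ∀ i → ∃ λ x → ℓ x ≡ i) where

  private
    leastOf : ∀ i → ∃ λ x → ℓ x ≡ i × (∀ y → ℓ y ≡ i → toℕ x ≤ toℕ y)
    leastOf i = least (λ x → ℓ x ≟ i) (ℓ-surjective i)

  representative : Fin m → Fin n
  representative i = proj₁ (leastOf i)

  ℓ-representative : ∀ i → ℓ (representative i) ≡ i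
  ℓ-representative i = proj₁ (proj₂ (leastOf i))

  representative-min : ∀ i → OrbitMin f (representative i)
  representative-min i y o = proj₂ (proj₂ (leastOf i)) y
    (trans (sym (orbit-invariant ℓ ℓ-invariant o)) (ℓ-representative i))

  card-orbits : Card (OrbitMin f) m
  card-orbits = representative , rightInv , λ a → mk⇔
      (λ min → ℓ a , orbitMin-unique inj (representative-min (ℓ a)) min (ℓ-orbit _ _ (ℓ-representative (ℓ a))))
      (λ where (i , refl) → representative-min i)
    where
    rightInv : Injective _≡_ _≡_ representative
    rightInv {i} {j} eq = trans (sym (ℓ-representative i)) (trans (cong ℓ eq) (ℓ-representative j))

-- Upper bound: joined pairs, tokens and Euler's formula

rot-injective : (M : Map) → Injective _≡_ _≡_ (Map.rot M)
rot-injective M = ↔-injective (Map.σ M)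

τ-injective : (M : Map) → Injective _≡_ _≡_ (Map.τ M)
τ-injective M eq = rightInverse-injective {f = Map.α M} (Map.α-invol M) (rot-injective M eq)

module JoinedPairs (M : Map) {A : ℕ} (joined : Map.ReducedEdges M A) where
  open Map M
  open CardOf joined public

  dart : Fin A → Fin darts
  dart p = proj₁ (proj₂ (proj₂ (proj₂ (elem-sat p))))

  src tgt : Fin A → Fin darts
  src p = proj₁ (elem p)
  tgt p = proj₂ (elem p)

  src-min : ∀ p → OrbitMin rot (src p)
  src-min p = proj₁ (elem-sat p)

  tgt-min : ∀ p → OrbitMin rot (tgt p)
  tgt-min p = proj₁ (proj₂ (elem-sat p))

  src<tgt : ∀ p → toℕ (src p) < toℕ (tgt p)
  src<tgt p = proj₁ (proj₂ (proj₂ (elem-sat p)))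

  src-dart : ∀ p → SameOrbit rot (src p) (dart p)
  src-dart p = proj₁ (proj₂ (proj₂ (proj₂ (proj₂ (elem-sat p)))))

  tgt-dart : ∀ p → SameOrbit rot (tgt p) (α (dart p))
  tgt-dart p = proj₂ (proj₂ (proj₂ (proj₂ (proj₂ (elem-sat p)))))

-- The two copies of a joined pair go to its two orders, which differ because `src` is below `tgt`.
2A≤S² : (M : Map) {S A : ℕ} → Map.NumVertices M S → Map.ReducedEdges M A → A + A ≤ S * S
2A≤S² M {S} {A} verts joined =
  ≤-from-injection (fin⊎ (↔-id _) (↔-id _)) (fin× (↔-id _) (↔-id _)) f f-injective
  where
  open JoinedPairs M joined
  module V = CardOf verts
  f : Fin A ⊎ Fin A → Fin S × Fin S
  f (inj₁ p) = V.index (src-min p) , V.index (tgt-min p)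
  f (inj₂ p) = V.index (tgt-min p) , V.index (src-min p)
  asym : ∀ p q → src p ≡ tgt q → tgt p ≡ src q → ⊥
  asym p q eq eq' = ℕₚ.<-asym (src<tgt p) (subst₂ (λ a b → toℕ a < toℕ b) (sym eq') (sym eq) (src<tgt q))
  f-injective : Injective _≡_ _≡_ f
  f-injective {inj₁ p} {inj₁ q} eq = cong inj₁ (elem-injective (cong₂ _,_
    (V.index-injective (src-min p) (src-min q) (cong proj₁ eq))
    (V.index-injective (tgt-min p) (tgt-min q) (cong proj₂ eq))))
  f-injective {inj₂ p} {inj₂ q} eq = cong inj₂ (elem-injective (cong₂ _,_
    (V.index-injective (src-min p) (src-min q) (cong proj₂ eq))
    (V.index-injective (tgt-min p) (tgt-min q) (cong proj₁ eq))))
  f-injective {inj₁ p} {inj₂ q} eq = ⊥-elim (asym p q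
    (V.index-injective (src-min p) (tgt-min q) (cong proj₁ eq))
    (V.index-injective (tgt-min p) (src-min q) (cong proj₂ eq)))
  f-injective {inj₂ p} {inj₁ q} eq = ⊥-elim (asym p q
    (V.index-injective (src-min p) (tgt-min q) (cong proj₂ eq))
    (V.index-injective (tgt-min p) (src-min q) (cong proj₁ eq)))

-- Every edge carries three tokens.  A joined pair spends tokens 1 and 2 of its chosen edge.  A face
-- other than the complete one spends three tokens of its own edges: all those of one of its first two
-- edges that is not chosen by a joined pair, or else (the face then has length at least three) token
-- 0 of its first three edges.  The complete face spends three extra tokens.
module Tokens (M : Map) {F A : ℕ} (complete : Map.HasCompleteLeftWalk M)
  (faces : Map.NumFaces M F) (joined : Map.ReducedEdges M A) where
  open Map M
  open JoinedPairs M joined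
  module Fc = CardOf faces

  d₀ : Fin darts
  d₀ = proj₁ complete

  Inner : Fin darts → Set
  Inner d = ¬ SameOrbit τ d₀ d

  _~_ : Fin darts → Fin darts → Set
  d ~ e = d ≡ e ⊎ d ≡ α e

  ~-sym : ∀ {d e} → d ~ e → e ~ d
  ~-sym (inj₁ eq) = inj₁ (sym eq)
  ~-sym {e = e} (inj₂ eq) = inj₂ (trans (sym (α-invol e)) (cong α (sym eq)))

  ~-trans : ∀ {d e f} → d ~ e → e ~ f → d ~ f
  ~-trans (inj₁ refl) q = q
  ~-trans (inj₂ refl) (inj₁ refl) = inj₂ refl
  ~-trans {f = f} (inj₂ refl) (inj₂ refl) = inj₁ (α-invol f)

  -- If both darts of an edge were off the complete walk, that walk would miss the edge. So an edge
  -- has at most one inner dart, and inner faces cannot share edges.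
  inner-~ : ∀ {d e} → Inner d → Inner e → d ~ e → d ≡ e
  inner-~ _ _ (inj₁ eq) = eq
  inner-~ {e = e} id ie (inj₂ refl) with proj₂ complete e
  ... | inj₁ o = ⊥-elim (ie o)
  ... | inj₂ o = ⊥-elim (id o)

  inner-orbit : ∀ {d e} → Inner d → SameOrbit τ d e → Inner e
  inner-orbit i o o' = i (orbit-trans o' (orbit-sym (τ-injective M) o))

  Chosen : Fin darts → Set
  Chosen d = ∃ λ p → d ~ dart p

  chosen? : Decidable Chosen
  chosen? d = any? (λ p → (d ≟ dart p) ⊎-dec (d ≟ α (dart p)))

  rot-sym : ∀ {x y} → SameOrbit rot x y → SameOrbit rot y x
  rot-sym = orbit-sym (rot-injective M)

  Ends : Fin darts → Fin A → Set
  Ends d p = (SameOrbit rot (src p) d × SameOrbit rot (tgt p) (α d))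
           ⊎ (SameOrbit rot (tgt p) d × SameOrbit rot (src p) (α d))

  ends : ∀ {d} p → d ~ dart p → Ends d p
  ends p (inj₁ refl) = inj₁ (src-dart p , tgt-dart p)
  ends p (inj₂ refl) = inj₂ (tgt-dart p , subst (SameOrbit rot (src p)) (sym (α-invol _)) (src-dart p))

  src≢tgt : ∀ p → src p ≢ tgt p
  src≢tgt p eq = ℕₚ.<⇒≢ (src<tgt p) (cong toℕ eq)

  chosen-not-loop : ∀ {d} → Chosen d → ¬ SameOrbit rot d (α d)
  chosen-not-loop (p , c) o with ends p c
  ... | inj₁ (s , t) = src≢tgt p (orbitMin-common (rot-injective M) (src-min p) (tgt-min p) (orbit-trans s o) t)
  ... | inj₂ (t , s) = src≢tgt p (orbitMin-common (rot-injective M) (src-min p) (tgt-min p) s (orbit-trans t o))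

  -- The ends of a joined pair are least darts with `src` below `tgt`, so a dart running between
  -- them, in either direction, fixes the pair.
  same-ends : ∀ {d p q} → Ends d p → Ends d q → p ≡ q
  same-ends {d} {p} {q} = go
    where
    common : ∀ {x y z} → OrbitMin rot x → OrbitMin rot y → SameOrbit rot x z → SameOrbit rot y z → x ≡ y
    common = orbitMin-common (rot-injective M)
    cross : src p ≡ tgt q → tgt p ≡ src q → p ≡ q
    cross eq eq' = ⊥-elim (ℕₚ.<-asym (src<tgt p)
      (subst₂ (λ a b → toℕ a < toℕ b) (sym eq') (sym eq) (src<tgt q)))
    go : Ends d p → Ends d q → p ≡ q
    go (inj₁ (s , t)) (inj₁ (s' , t')) = elem-injective
      (cong₂ _,_ (common (src-min p) (src-min q) s s') (common (tgt-min p) (tgt-min q) t t'))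
    go (inj₂ (t , s)) (inj₂ (t' , s')) = elem-injective
      (cong₂ _,_ (common (src-min p) (src-min q) s s') (common (tgt-min p) (tgt-min q) t t'))
    go (inj₁ (s , t)) (inj₂ (t' , s')) = cross (common (src-min p) (tgt-min q) s t') (common (tgt-min p) (src-min q) t s')
    go (inj₂ (t , s)) (inj₁ (s' , t')) = cross (common (src-min p) (tgt-min q) s t') (common (tgt-min p) (src-min q) t s')

  chosen-parallel : ∀ {d e} → Chosen d → Chosen e → SameOrbit rot (α d) e → SameOrbit rot (α e) d → d ~ e
  chosen-parallel {d} {e} (p , c) (q , c') o o' with same-ends {p = p} {q} (reverse (ends p c)) (ends q c')
    where
    reverse : Ends d p → Ends e p
    reverse (inj₁ (s , t)) = inj₂ (orbit-trans t o , orbit-trans s (rot-sym o'))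
    reverse (inj₂ (t , s)) = inj₁ (orbit-trans s o , orbit-trans t (rot-sym o'))
  ... | refl = ~-trans c (~-sym c')

  τ-source : ∀ d → SameOrbit rot (α d) (τ d)
  τ-source d = orbit-step

  τ-moves : ∀ {d} → Chosen d → τ d ≢ d
  τ-moves {d} c eq = chosen-not-loop c (rot-sym (subst (SameOrbit rot (α d)) eq (τ-source d)))

  -- A face of length two is bounded by two parallel edges. Both being chosen, they are one edge;
  -- both darts being inner, they are one dart, and the face would be a chosen loop.
  τ²-moves : ∀ {d} → Inner d → Chosen d → Chosen (τ d) → τ (τ d) ≢ d
  τ²-moves {d} i c c' eq = τ-moves c (sym (inner-~ i (inner-orbit i orbit-step)
    (chosen-parallel c c' (τ-source d) (subst (SameOrbit rot (α (τ d))) eq (τ-source (τ d))))))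

  three-distinct : ∀ {d} → Inner d → Chosen d → Chosen (τ d) →
    (j k : Fin 3) → iter τ (toℕ j) d ≡ iter τ (toℕ k) d → j ≡ k
  three-distinct i c c' zero zero eq = refl
  three-distinct i c c' zero (suc zero) eq = ⊥-elim (τ-moves c (sym eq))
  three-distinct i c c' zero (suc (suc zero)) eq = ⊥-elim (τ²-moves i c c' (sym eq))
  three-distinct i c c' (suc zero) zero eq = ⊥-elim (τ-moves c eq)
  three-distinct i c c' (suc zero) (suc zero) eq = refl
  three-distinct i c c' (suc zero) (suc (suc zero)) eq = ⊥-elim (τ-moves c' (sym eq))
  three-distinct i c c' (suc (suc zero)) zero eq = ⊥-elim (τ²-moves i c c' eq)
  three-distinct i c c' (suc (suc zero)) (suc zero) eq = ⊥-elim (τ-moves c' eq)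
  three-distinct i c c' (suc (suc zero)) (suc (suc zero)) eq = refl

  data Kind (r : Fin darts) : Set where
    outer : SameOrbit τ d₀ r → Kind r
    spare : (e : Fin darts) → Inner r → SameOrbit τ r e → ¬ Chosen e → Kind r
    long : Inner r → Chosen r → Chosen (τ r) → Kind r

  kind : ∀ r → Kind r
  kind r with orbit? (τ-injective M) d₀ r | chosen? r | chosen? (τ r)
  ... | yes o | _ | _ = outer o
  ... | no i | no ¬c | _ = spare r i orbit-refl ¬c
  ... | no i | yes c | no ¬c' = spare (τ r) i orbit-step ¬c'
  ... | no i | yes c | yes c' = long i c c'

  Token : Set
  Token = (Fin darts × Fin 3) ⊎ Fin 3

  kindToken : ∀ {r} → Kind r → Fin 3 → Token
  kindToken (outer _) j = inj₂ j
  kindToken (spare e _ _ _) j = inj₁ (e , j)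
  kindToken {r} (long _ _ _) j = inj₁ (iter τ (toℕ j) r , zero)

  token : (Fin F × Fin 3) ⊎ (Fin A × Fin 2) → Token
  token (inj₁ (i , j)) = kindToken (kind (Fc.elem i)) j
  token (inj₂ (p , j)) = inj₁ (dart p , suc j)

  -- Tokens belong to unoriented edges but are written with darts; this is equality up to reversal
  -- of the dart.
  data _≈_ : Token → Token → Set where
    edge : ∀ {d e j} → d ~ e → inj₁ (d , j) ≈ inj₁ (e , j)
    extra : ∀ {j} → inj₂ j ≈ inj₂ j

  kindToken-injective : ∀ {r} (k : Kind r) {j j'} → kindToken k j ≈ kindToken k j' → j ≡ j'
  kindToken-injective (outer _) extra = refl
  kindToken-injective (spare _ _ _ _) (edge _) = refl
  kindToken-injective {r} (long i c c') {j} {j'} (edge p) = three-distinct i c c' j j'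
    (inner-~ (inner-orbit i (toℕ j , refl)) (inner-orbit i (toℕ j' , refl)) p)

  -- What disjointness needs of a token spent by a face: its dart is inner and lies on that face,
  -- and a chosen edge gives up token 0 only, which keeps tokens 1 and 2 for the joined pair.
  data OnFace (r : Fin darts) : Token → Set where
    outside : ∀ {j} → SameOrbit τ d₀ r → OnFace r (inj₂ j)
    inside : ∀ {d j} → Inner r → SameOrbit τ r d → (Chosen d → j ≡ zero) → OnFace r (inj₁ (d , j))

  kindToken-onFace : ∀ {r} (k : Kind r) j → OnFace r (kindToken k j)
  kindToken-onFace (outer o) j = outside o
  kindToken-onFace (spare _ i o ¬c) j = inside i o (⊥-elim ∘ ¬c)
  kindToken-onFace (long i _ _) j = inside i (toℕ j , refl) (λ _ → refl)

  onFace-orbit : ∀ {r r' s t} → OnFace r s → OnFace r' t → s ≈ t → SameOrbit τ r r'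
  onFace-orbit (outside o) (outside o') extra = orbit-trans (orbit-sym (τ-injective M) o) o'
  onFace-orbit {r} (inside i o _) (inside i' o' _) (edge p) = orbit-trans
    (subst (SameOrbit τ r) (inner-~ (inner-orbit i o) (inner-orbit i' o') p) o)
    (orbit-sym (τ-injective M) o')

  onFace-not-joined : ∀ {r s} p j → OnFace r s → ¬ (s ≈ token (inj₂ (p , j)))
  onFace-not-joined p j (inside _ _ z) (edge e) with z (p , e)
  ... | ()

  ≈-sym : ∀ {s t} → s ≈ t → t ≈ s
  ≈-sym (edge p) = edge (~-sym p)
  ≈-sym extra = extra

  token-injective : ∀ x y → token x ≈ token y → x ≡ y
  token-injective (inj₁ (i , j)) (inj₁ (i' , j')) eq
    with Fc.elem-injective (orbitMin-unique (τ-injective M) (Fc.elem-sat i) (Fc.elem-sat i')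
           (onFace-orbit (kindToken-onFace (kind (Fc.elem i)) j) (kindToken-onFace (kind (Fc.elem i')) j') eq))
  ... | refl = cong (λ j → inj₁ (i , j)) (kindToken-injective (kind (Fc.elem i)) eq)
  token-injective (inj₁ (i , j)) (inj₂ (p , k)) eq =
    ⊥-elim (onFace-not-joined p k (kindToken-onFace (kind (Fc.elem i)) j) eq)
  token-injective (inj₂ (p , k)) (inj₁ (i , j)) eq =
    ⊥-elim (onFace-not-joined p k (kindToken-onFace (kind (Fc.elem i)) j) (≈-sym eq))
  token-injective (inj₂ (p , k)) (inj₂ (q , l)) (edge e)
    with same-ends {p = p} {q} (ends p (inj₁ refl)) (ends q e)
  ... | refl = refl

  flip : Fin 2 → Fin darts → Fin darts
  flip zero d = d
  flip (suc zero) d = α d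

  flip-~ : ∀ b d → flip b d ~ d
  flip-~ zero d = inj₁ refl
  flip-~ (suc zero) d = inj₂ refl

  flip-injective : ∀ b b' d → flip b d ≡ flip b' d → b ≡ b'
  flip-injective zero zero d eq = refl
  flip-injective zero (suc zero) d eq = ⊥-elim (α-free d (sym eq))
  flip-injective (suc zero) zero d eq = ⊥-elim (α-free d eq)
  flip-injective (suc zero) (suc zero) d eq = refl

  -- An unoriented edge has no preferred dart. Taking every token twice, once for each dart of its
  -- edge, turns the count of edges into a count of darts.
  sided : Token → Fin 2 → (Fin darts × Fin 3) ⊎ (Fin 3 × Fin 2)
  sided (inj₁ (d , j)) b = inj₁ (flip b d , j)
  sided (inj₂ j) b = inj₂ (j , b)

  sided-≈ : ∀ s t {b b'} → sided s b ≡ sided t b' → s ≈ t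
  sided-≈ (inj₁ (d , j)) (inj₁ (e , j')) {b} {b'} eq with inj₁-injective eq
  ... | eq' with cong proj₂ eq'
  ... | refl = edge (~-trans (~-sym (flip-~ b d)) (~-trans (inj₁ (cong proj₁ eq')) (flip-~ b' e)))
  sided-≈ (inj₂ j) (inj₂ j') refl = extra

  sided-injective : ∀ s {b b'} → sided s b ≡ sided s b' → b ≡ b'
  sided-injective (inj₁ (d , j)) {b} {b'} eq = flip-injective b b' d (cong proj₁ (inj₁-injective eq))
  sided-injective (inj₂ j) refl = refl

  token-count : (F * 3 + A * 2) * 2 ≤ darts * 3 + 3 * 2
  token-count = ≤-from-injection
    (fin× (fin⊎ (fin× (↔-id _) (↔-id _)) (fin× (↔-id _) (↔-id _))) (↔-id _))
    (fin⊎ (fin× (↔-id _) (↔-id _)) (fin× (↔-id _) (↔-id _)))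
    (λ (x , b) → sided (token x) b)
    (λ { {x , b} {y , b'} → injective x y b b' })
    where
    injective : ∀ x y b b' → sided (token x) b ≡ sided (token y) b' → (x , b) ≡ (y , b')
    injective x y b b' eq with token-injective x y (sided-≈ (token x) (token y) eq)
    ... | refl = cong (x ,_) (sided-injective (token x) eq)

2A≤3S+6g : (M : Map) {S A g : ℕ} → Map.CellularGenus M g → Map.HasCompleteLeftWalk M →
  Map.NumVertices M S → Map.ReducedEdges M A → A + A ≤ 3 * S + 6 * g
2A≤3S+6g M {S} {A} {g} (S' , F , E , darts≡ , verts' , faces , euler) complete verts joined
  with card-unique verts verts'
... | refl = ℕₚ.+-cancelˡ-≤ (F * 3) _ _ (begin
  F * 3 + (A + A) ≡⟨ cong (F * 3 +_) (double A) ⟩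
  F * 3 + A * 2 ≤⟨ ℕₚ.*-cancelʳ-≤ _ _ 2 (ℕₚ.≤-trans (Tokens.token-count M complete faces joined) (ℕₚ.≤-reflexive (begin-equality
    Map.darts M * 3 + 3 * 2 ≡⟨ cong (λ n → n * 3 + 3 * 2) darts≡ ⟩
    (E + E) * 3 + 3 * 2 ≡⟨ arith₁ E ⟩
    ((1 + E) * 3) * 2 ∎))) ⟩
  -- The tokens give a bound smaller by 3; the slack produces the `2 + E` of `euler`.
  (1 + E) * 3 ≤⟨ ℕₚ.*-monoˡ-≤ 3 (ℕₚ.n≤1+n (1 + E)) ⟩
  (2 + E) * 3 ≡⟨ cong (_* 3) euler ⟨
  (S + F + 2 * g) * 3 ≡⟨ arith₂ S F g ⟩
  F * 3 + (3 * S + 6 * g) ∎)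
  where
  open ℕₚ.≤-Reasoning
  double : ∀ a → a + a ≡ a * 2
  double = solve-∀
  arith₁ : ∀ e → (e + e) * 3 + 3 * 2 ≡ ((1 + e) * 3) * 2
  arith₁ = solve-∀
  arith₂ : ∀ s f h → (s + f + 2 * h) * 3 ≡ f * 3 + (3 * s + 6 * h)
  arith₂ = solve-∀

-- With X = 6g: if S² ≤ X use 2A ≤ S², and if X ≤ S² use 2A ≤ 3S + X.
valence-upper : ∀ K A S X → 36 * (K * K) ≤ X → 1 ≤ K → A + A ≤ S * S → A + A ≤ 3 * S + X →
  (2 * A) ^ 2 * K ^ 2 ≤ (K + 1) ^ 2 * X * S ^ 2
valence-upper K A S X X-large 1≤K A≤ A≤' with ℕₚ.≤-total (S * S) X
... | inj₁ small = begin
  (2 * A) ^ 2 * K ^ 2 ≡⟨ e₁ A K ⟩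
  (A + A) * (A + A) * (K * K) ≤⟨ ℕₚ.*-mono-≤ (ℕₚ.*-mono-≤ A≤ A≤) (ℕₚ.*-mono-≤ (ℕₚ.m≤m+n K 1) (ℕₚ.m≤m+n K 1)) ⟩
  (S * S) * (S * S) * ((K + 1) * (K + 1)) ≤⟨ ℕₚ.*-monoˡ-≤ ((K + 1) * (K + 1)) (ℕₚ.*-monoˡ-≤ (S * S) small) ⟩
  X * (S * S) * ((K + 1) * (K + 1)) ≡⟨ e₂ X S K ⟩
  (K + 1) ^ 2 * X * S ^ 2 ∎
  where
  open ℕₚ.≤-Reasoning
  e₁ : ∀ a k → 2 * a * (2 * a * 1) * (k * (k * 1)) ≡ (a + a) * (a + a) * (k * k)
  e₁ = solve-∀
  e₂ : ∀ x s k → x * (s * s) * ((k + 1) * (k + 1)) ≡ (k + 1) * ((k + 1) * 1) * x * (s * (s * 1))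
  e₂ = solve-∀
... | inj₂ big = begin
  (2 * A) ^ 2 * K ^ 2 ≡⟨ e₁ A K ⟩
  (A + A) * (A + A) * (K * K) ≤⟨ ℕₚ.*-monoˡ-≤ (K * K) (ℕₚ.*-mono-≤ A≤' A≤') ⟩
  (3 * S + X) * (3 * S + X) * (K * K) ≡⟨ e₂ S X K ⟩
  -- From `36 K² ≤ X ≤ S²` follows `6K ≤ S`. The square is cut so that its three terms are at most
  -- K, K and K² times `X S²`, one less than (K + 1)² in total.
  9 * (K * K) * (S * S) + K * (S * X) * (6 * K) + K * K * X * X ≤⟨ ℕₚ.+-mono-≤ (ℕₚ.+-mono-≤ step₁ step₂) step₃ ⟩
  K * X * (S * S) + K * (S * X) * S + K * K * X * (S * S) ≤⟨ ℕₚ.m≤m+n _ (X * (S * S)) ⟩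
  K * X * (S * S) + K * (S * X) * S + K * K * X * (S * S) + X * (S * S) ≡⟨ e₃ K X S ⟩
  (K + 1) ^ 2 * X * S ^ 2 ∎
  where
  open ℕₚ.≤-Reasoning
  e₁ : ∀ a k → 2 * a * (2 * a * 1) * (k * (k * 1)) ≡ (a + a) * (a + a) * (k * k)
  e₁ = solve-∀
  e₂ : ∀ s x k → (3 * s + x) * (3 * s + x) * (k * k) ≡ 9 * (k * k) * (s * s) + k * (s * x) * (6 * k) + k * k * x * x
  e₂ = solve-∀
  e₃ : ∀ k x s → k * x * (s * s) + k * (s * x) * s + k * k * x * (s * s) + x * (s * s) ≡ (k + 1) * ((k + 1) * 1) * x * (s * (s * 1))
  e₃ = solve-∀
  e₄ : ∀ k → (6 * k) * (6 * k) ≡ 36 * (k * k)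
  e₄ = solve-∀
  S-large : 6 * K ≤ S
  S-large with 6 * K ℕₚ.≤? S
  ... | yes le = le
  ... | no gt = ⊥-elim (ℕₚ.<⇒≱ (ℕₚ.*-mono-< (ℕₚ.≰⇒> gt) (ℕₚ.≰⇒> gt))
    (ℕₚ.≤-trans (ℕₚ.≤-reflexive (e₄ K)) (ℕₚ.≤-trans X-large big)))
  X≥9K : 9 * (K * K) ≤ K * X
  X≥9K = ℕₚ.≤-trans (ℕₚ.*-monoˡ-≤ (K * K) (ℕₚ.m≤m+n 9 27))
    (ℕₚ.≤-trans X-large (ℕₚ.≤-trans (ℕₚ.≤-reflexive (sym (ℕₚ.*-identityˡ X))) (ℕₚ.*-monoˡ-≤ X 1≤K)))
  step₁ : 9 * (K * K) * (S * S) ≤ K * X * (S * S)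
  step₁ = ℕₚ.*-monoˡ-≤ (S * S) X≥9K
  step₂ : K * (S * X) * (6 * K) ≤ K * (S * X) * S
  step₂ = ℕₚ.*-monoʳ-≤ (K * (S * X)) S-large
  step₃ : K * K * X * X ≤ K * K * X * (S * S)
  step₃ = ℕₚ.*-monoʳ-≤ (K * K * X) big

-- Maps with a complete outer walk, and plane trees

-- For a permutation modified at a few darts, surjectivity is a list of predecessors, whereas
-- injectivity would compare all pairs of cases.
surjective⇒injective : ∀ {n} {f : Fin n → Fin n} → (∀ y → ∃ λ x → f x ≡ y) → Injective _≡_ _≡_ f
surjective⇒injective {f = f} surj = rightInverse-injective {f = proj₁ ∘ surj}
  (rightInverse⇒leftInverse {f = f} (proj₂ ∘ surj))

-- One step of `f` may become several steps of `g`: this happens to rotations when new darts are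
-- inserted between old ones.
orbit-map : {A B : Set} {f : A → A} {g : B → B} (h : A → B) → (∀ x → SameOrbit g (h x) (h (f x))) →
  ∀ {x y} → SameOrbit f x y → SameOrbit g (h x) (h y)
orbit-map {A} {f = f} {g} h step {x} (k , refl) = go k
  where
  go : ∀ k → SameOrbit g (h x) (h (iter f k x))
  go zero = orbit-refl
  go (suc k) = orbit-trans (go k) (step _)

Unique-resp-↭ : {A : Set} {xs ys : List A} → xs ↭ ys → Unique xs → Unique ys
Unique-resp-↭ {A} p = SetoidPermₚ.Unique-resp-↭ (setoid A) (↭⇒↭ₛ p)

-- The end point is not listed, so walks concatenate without overlap and a closed walk lists each of
-- its steps once.
data Walk {A : Set} (f : A → A) : A → List A → A → Set where
  []   : ∀ {x} → Walk f x [] x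
  step : ∀ {x y xs} → Walk f (f x) xs y → Walk f x (x ∷ xs) y

module _ {A : Set} {f : A → A} where

  walk-++ : ∀ {x y z xs ys} → Walk f x xs y → Walk f y ys z → Walk f x (xs ++ ys) z
  walk-++ [] w' = w'
  walk-++ (step w) w' = step (walk-++ w w')

  walk-split : ∀ {x z} xs {ys} → Walk f x (xs ++ ys) z → ∃ λ y → Walk f x xs y × Walk f y ys z
  walk-split [] w = _ , [] , w
  walk-split (_ ∷ xs) (step w) with walk-split xs w
  ... | y , w₁ , w₂ = y , step w₁ , w₂

  walk-orbit : ∀ {x y z xs} → Walk f x xs y → z ∈ xs → SameOrbit f x z
  walk-orbit (step w) (here refl) = orbit-refl
  walk-orbit (step w) (there i) = orbit-trans orbit-step (walk-orbit w i)

walk-map : {A B : Set} {f : A → A} {g : B → B} (h : A → B) {x y : A} {xs : List A} →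
  (∀ {z} → z ∈ xs → g (h z) ≡ h (f z)) → Walk f x xs y → Walk g (h x) (map h xs) (h y)
walk-map h eq [] = []
walk-map {g = g} h {x} {y} {_ ∷ xs} eq (step w) =
  step (subst (λ z → Walk g z (map h xs) (h y)) (sym (eq (here refl))) (walk-map h (eq ∘ there) w))

-- A map with S vertices (labelled by v) and 1 + T faces (labelled by f), whose face 0 is a complete
-- left walk, listed by W.
record Unicellular (S T : ℕ) : Set where
  field
    n : ℕ
    τ α : Fin n → Fin n
    τ-surjective : ∀ d → ∃ λ e → τ e ≡ d
    α-invol : ∀ d → α (α d) ≡ d
    α-free : ∀ d → α d ≢ d
    v : Fin n → Fin S
    v-τ : ∀ d → v (τ d) ≡ v (α d)
    v-orbit : ∀ d e → v d ≡ v e → SameOrbit (τ ∘ α) d e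
    start : Fin n
    W : List (Fin n)
    walk : Walk τ start W start
    unique : Unique W
    f : Fin n → Fin (suc T)
    W-outer : ∀ {d} → d ∈ W → f d ≡ zero
    outer-W : ∀ {d} → f d ≡ zero → d ∈ W
    f-τ : ∀ d → f (τ d) ≡ f d
    f-orbit : ∀ d e → f d ≡ f e → f d ≢ zero → SameOrbit τ d e
    f-surjective : ∀ i → ∃ λ d → f d ≡ i
    complete : ∀ d → f d ≡ zero ⊎ f (α d) ≡ zero
    heads : ∀ s → ∃ λ d → d ∈ W × v (α d) ≡ s
    -- That is, E = S - 1 + 3T: a spanning tree and three edges for each triangle.
    n-count : 2 + n ≡ S + S + 6 * T

  τ-inj : Injective _≡_ _≡_ τ
  τ-inj = surjective⇒injective τ-surjective

  α-inj : Injective _≡_ _≡_ α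
  α-inj = rightInverse-injective {f = α} α-invol

  Joined : Fin S → Fin S → Set
  Joined s t = ∃ λ d → v d ≡ s × v (α d) ≡ t

  Joined-sym : ∀ {s t} → Joined s t → Joined t s
  Joined-sym (d , p , q) = α d , q , trans (cong v (α-invol d)) p

-- The one-vertex tree has no dart to serve as `start`, so the trees begin with two vertices.
singleEdge : Unicellular 2 0
singleEdge = record
  { n = 2 ; τ = swap ; α = swap
  ; τ-surjective = λ d → swap d , swap-invol d
  ; α-invol = swap-invol
  ; α-free = λ where
      zero ()
      (suc zero) ()
  ; v = id
  ; v-τ = λ _ → refl
  ; v-orbit = λ where d .d refl → orbit-refl
  ; start = zero
  ; W = zero ∷ suc zero ∷ []
  ; walk = step (step [])
  ; unique = ((λ ()) ∷ []) ∷ [] ∷ []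
  ; f = λ _ → zero
  ; W-outer = λ _ → refl
  ; outer-W = λ {d} _ → all∈ d
  ; f-τ = λ _ → refl
  ; f-orbit = λ d e _ ne → ⊥-elim (ne refl)
  ; f-surjective = λ where zero → zero , refl
  ; complete = λ _ → inj₁ refl
  ; heads = λ s → swap s , all∈ (swap s) , swap-invol s
  ; n-count = refl
  }
  where
  swap : Fin 2 → Fin 2
  swap zero = suc zero
  swap (suc zero) = zero
  swap-invol : ∀ d → swap (swap d) ≡ d
  swap-invol zero = refl
  swap-invol (suc zero) = refl
  all∈ : ∀ (d : Fin 2) → d ∈ (zero ∷ suc zero ∷ [])
  all∈ zero = here refl
  all∈ (suc zero) = there (here refl)

-- Insert a pendant edge after the dart p of the outer walk: dart 0 leads to the new vertex, 1 back.
module Pendant {S T : ℕ} (U : Unicellular S T) where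
  open Unicellular U

  module _ (p : Fin n) (X Q : List (Fin n)) (W≡ : W ≡ X ++ p ∷ Q) where

    old : Fin n → Fin (2 + n)
    old = 2 ↑ʳ_

    old-inj : Injective _≡_ _≡_ old
    old-inj = ↑ʳ-injective 2 _ _

    redirect : ∀ d → Dec (d ≡ p) → Fin (2 + n)
    redirect d (yes _) = zero
    redirect d (no _) = old (τ d)

    τ′ : Fin (2 + n) → Fin (2 + n)
    τ′ zero = suc zero
    τ′ (suc zero) = old (τ p)
    τ′ (suc (suc d)) = redirect d (d ≟ p)

    α′ : Fin (2 + n) → Fin (2 + n)
    α′ zero = suc zero
    α′ (suc zero) = zero
    α′ (suc (suc d)) = old (α d)

    τ′-p : τ′ (old p) ≡ zero
    τ′-p with p ≟ p
    ... | yes _ = refl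
    ... | no ne = ⊥-elim (ne refl)

    τ′-other : ∀ {d} → d ≢ p → τ′ (old d) ≡ old (τ d)
    τ′-other {d} ne with d ≟ p
    ... | yes eq = ⊥-elim (ne eq)
    ... | no _ = refl

    τ′-surjective : ∀ y → ∃ λ x → τ′ x ≡ y
    τ′-surjective zero = old p , τ′-p
    τ′-surjective (suc zero) = zero , refl
    τ′-surjective (suc (suc y)) with τ-surjective y
    ... | x , refl with x ≟ p
    ... | yes refl = suc zero , refl
    ... | no ne = old x , τ′-other ne

    α′-invol : ∀ d → α′ (α′ d) ≡ d
    α′-invol zero = refl
    α′-invol (suc zero) = refl
    α′-invol (suc (suc d)) = cong old (α-invol d)

    α′-free : ∀ d → α′ d ≢ d
    α′-free zero ()
    α′-free (suc zero) ()
    α′-free (suc (suc d)) eq = α-free d (old-inj eq)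

    v′ : Fin (2 + n) → Fin (suc S)
    v′ zero = suc (v (α p))
    v′ (suc zero) = zero
    v′ (suc (suc d)) = suc (v d)

    v′-τ′ : ∀ d → v′ (τ′ d) ≡ v′ (α′ d)
    v′-τ′ zero = refl
    v′-τ′ (suc zero) = cong suc (v-τ p)
    v′-τ′ (suc (suc d)) with d ≟ p
    ... | yes refl = refl
    ... | no _ = cong suc (v-τ d)

    ρ′ : Fin (2 + n) → Fin (2 + n)
    ρ′ = τ′ ∘ α′

    ρ′-inj : Injective _≡_ _≡_ ρ′
    ρ′-inj eq = rightInverse-injective {f = α′} {α′} α′-invol (surjective⇒injective {f = τ′} τ′-surjective eq)

    -- In the rotation at the head of `p`, the new dart 0 now sits between `α p` and `τ p`.
    old-step : ∀ d → SameOrbit ρ′ (old d) (old (τ (α d)))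
    old-step d with α d ≟ p in eq
    ... | yes refl = 2 , cong ρ′ (cong (redirect (α d)) eq)
    ... | no _ = 1 , cong (redirect (α d)) eq

    anchor : ∀ x {s} → v′ x ≡ suc s → ∃ λ d → v d ≡ s × SameOrbit ρ′ (old d) x
    anchor zero refl = α p , refl , 1 , trans (cong (τ′ ∘ old) (α-invol p)) τ′-p
    anchor (suc (suc d)) refl = d , refl , orbit-refl

    only-end : ∀ x → v′ x ≡ zero → x ≡ suc zero
    only-end (suc zero) _ = refl

    v′-orbit : ∀ x y → v′ x ≡ v′ y → SameOrbit ρ′ x y
    v′-orbit x y eq with v′ x in eqx
    ... | zero rewrite only-end x eqx | only-end y (sym eq) = orbit-refl
    ... | suc s with anchor x eqx | anchor y (sym eq)
    ... | d , p , o | e , q , o' = orbit-trans (orbit-sym ρ′-inj o)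
      (orbit-trans (orbit-map old old-step (v-orbit d e (trans p (sym q)))) o')

    W′ : List (Fin (2 + n))
    W′ = map old X ++ old p ∷ zero ∷ suc zero ∷ map old Q

    -- Membership in the new outer walk and its lack of repetitions ignore the order, and are
    -- transported along this permutation; only `walk′` looks at the order.
    W′-↭ : W′ ↭ zero ∷ suc zero ∷ map old W
    W′-↭ = begin
      map old X ++ [ old p ] ++ zero ∷ suc zero ∷ map old Q ≡⟨ ++-assoc (map old X) [ old p ] _ ⟨
      (map old X ++ [ old p ]) ++ zero ∷ suc zero ∷ map old Q ↭⟨ shifts (map old X ++ [ old p ]) (zero ∷ suc zero ∷ []) ⟩
      zero ∷ suc zero ∷ (map old X ++ [ old p ]) ++ map old Q ≡⟨ cong (λ L → zero ∷ suc zero ∷ L) (++-assoc (map old X) [ old p ] _) ⟩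
      zero ∷ suc zero ∷ map old X ++ old p ∷ map old Q ≡⟨ cong (λ L → zero ∷ suc zero ∷ L) (map-++ old X (p ∷ Q)) ⟨
      zero ∷ suc zero ∷ map old (X ++ p ∷ Q) ≡⟨ cong (λ L → zero ∷ suc zero ∷ map old L) W≡ ⟨
      zero ∷ suc zero ∷ map old W ∎
      where open PermutationReasoning

    p-once : All (p ≢_) (X ++ Q)
    p-once with Unique-resp-↭ (shift p X Q) (subst Unique W≡ unique)
    ... | a ∷ _ = a

    regular : ∀ {d} → d ∈ X ++ Q → τ′ (old d) ≡ old (τ d)
    regular i = τ′-other (λ eq → All.lookup p-once i (sym eq))

    walk′ : Walk τ′ (old start) W′ (old start)
    walk′ with walk-split X (subst (λ L → Walk τ start L start) W≡ walk)
    ... | .p , w₁ , step w₂ = walk-++ (walk-map old (regular ∘ ∈-++⁺ˡ) w₁)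
      (step (subst (λ x → Walk τ′ x _ (old start)) (sym τ′-p)
        (step (step (walk-map old (regular ∘ ∈-++⁺ʳ X) w₂)))))

    unique′ : Unique W′
    unique′ = Unique-resp-↭ (↭-sym W′-↭)
      (((λ ()) ∷ Allₚ.map⁺ (All.universal (λ _ ()) W))
      ∷ Allₚ.map⁺ (All.universal (λ _ ()) W)
      ∷ Uniqueₚ.map⁺ old-inj unique)

    f′ : Fin (2 + n) → Fin (suc T)
    f′ zero = zero
    f′ (suc zero) = zero
    f′ (suc (suc d)) = f d

    old-∈ : ∀ {d} → d ∈ W → old d ∈ W′
    old-∈ i = ∈-resp-↭ (↭-sym W′-↭) (there (there (∈-map⁺ old i)))

    W′-outer : ∀ {d} → d ∈ W′ → f′ d ≡ zero
    W′-outer {zero} _ = refl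
    W′-outer {suc zero} _ = refl
    W′-outer {suc (suc d)} i with ∈-resp-↭ W′-↭ i
    ... | there (there j) with ∈-map⁻ old j
    ... | e , e∈ , refl = W-outer e∈

    outer-W′ : ∀ {d} → f′ d ≡ zero → d ∈ W′
    outer-W′ {zero} _ = ∈-resp-↭ (↭-sym W′-↭) (here refl)
    outer-W′ {suc zero} _ = ∈-resp-↭ (↭-sym W′-↭) (there (here refl))
    outer-W′ {suc (suc d)} eq = old-∈ (outer-W eq)

    p∈W : p ∈ W
    p∈W = subst (p ∈_) (sym W≡) (∈-insert X)

    f′-τ′ : ∀ d → f′ (τ′ d) ≡ f′ d
    f′-τ′ zero = refl
    f′-τ′ (suc zero) = trans (f-τ p) (W-outer p∈W)
    f′-τ′ (suc (suc d)) with d ≟ p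
    ... | yes refl = sym (W-outer p∈W)
    ... | no _ = f-τ d

    -- An inner face never meets `p`, the only old dart whose successor has changed.
    inner-iter : ∀ k {d} → f d ≢ zero → iter τ′ k (old d) ≡ old (iter τ k d)
    inner-iter zero ne = refl
    inner-iter (suc k) {d} ne = trans (cong τ′ (inner-iter k ne)) (τ′-other (λ eq → ne
      (trans (orbit-invariant f f-τ (k , refl)) (trans (cong f eq) (W-outer p∈W)))))

    f′-orbit : ∀ x y → f′ x ≡ f′ y → f′ x ≢ zero → SameOrbit τ′ x y
    f′-orbit zero y eq ne = ⊥-elim (ne refl)
    f′-orbit (suc zero) y eq ne = ⊥-elim (ne refl)
    f′-orbit (suc (suc d)) zero eq ne = ⊥-elim (ne eq)
    f′-orbit (suc (suc d)) (suc zero) eq ne = ⊥-elim (ne eq)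
    f′-orbit (suc (suc d)) (suc (suc e)) eq ne with f-orbit d e eq ne
    ... | k , q = k , trans (inner-iter k ne) (cong old q)

    complete′ : ∀ d → f′ d ≡ zero ⊎ f′ (α′ d) ≡ zero
    complete′ zero = inj₁ refl
    complete′ (suc zero) = inj₁ refl
    complete′ (suc (suc d)) = complete d

    heads′ : ∀ s → ∃ λ d → d ∈ W′ × v′ (α′ d) ≡ s
    heads′ zero = zero , outer-W′ refl , refl
    heads′ (suc s) with heads s
    ... | d , i , eq = old d , old-∈ i , cong suc eq

    insert : Unicellular (suc S) T
    insert = record
      { n = 2 + n ; τ = τ′ ; α = α′ ; τ-surjective = τ′-surjective
      ; α-invol = α′-invol ; α-free = α′-free
      ; v = v′ ; v-τ = v′-τ′ ; v-orbit = v′-orbit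
      ; start = old start ; W = W′ ; walk = walk′ ; unique = unique′
      ; f = f′ ; W-outer = W′-outer ; outer-W = outer-W′ ; f-τ = f′-τ′ ; f-orbit = f′-orbit
      ; f-surjective = λ i → old (proj₁ (f-surjective i)) , proj₂ (f-surjective i)
      ; complete = complete′ ; heads = heads′
      ; n-count = trans (cong (2 +_) n-count) (cong (λ m → suc (m + 6 * T)) (sym (ℕₚ.+-suc S S)))
      }

tree : ∀ j → Unicellular (2 + j) 0
tree zero = singleEdge
-- Vertex `zero` is the one added last, so the tree that grows is a path.
tree (suc j) = Pendant.insert (tree j) p _ _ (proj₂ (proj₂ (∈-∃++ p∈W)))
  where
  open Unicellular (tree j)
  p : Fin n
  p = proj₁ (heads zero)
  p∈W : p ∈ W
  p∈W = proj₁ (proj₂ (heads zero))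

-- Gluing a triangle to the outer walk

walk-last : {A : Set} {f : A → A} {x y p : A} → ∀ xs → Walk f x (xs ++ [ p ]) y → Walk f x xs p × f p ≡ y
walk-last xs w with walk-split xs w
... | _ , w₁ , step [] = w₁ , refl

gather : {A : Set} (x y z : A) (X Y Z Q : List A) →
  X ++ x ∷ Y ++ y ∷ Z ++ z ∷ Q ↭ x ∷ y ∷ z ∷ X ++ Y ++ Z ++ Q
gather x y z X Y Z Q = ↭-trans (shift x X _) (prep x (↭-trans (↭-reflexive (sym (++-assoc X Y _)))
  (↭-trans (shift y (X ++ Y) _) (prep y (↭-trans (↭-reflexive (sym (++-assoc (X ++ Y) Z _)))
  (↭-trans (shift z ((X ++ Y) ++ Z) Q) (prep z (↭-reflexive
    (trans (++-assoc (X ++ Y) Z Q) (++-assoc X Y (Z ++ Q)))))))))))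

-- Insert a triangle joining the heads a, b, c of three darts p, q, r of the outer walk Xp Yq Zr Q.
-- Its darts are 0 : a → b, 2 : c → a, 4 : b → c, with reverses 1, 3, 5.  The outer walk becomes
-- Xp 0 Zr 2 Yq 4 Q, and 1 3 5 is the only new face, so the genus increases by one.
module Triangle {S T : ℕ} (U : Unicellular S T) where
  open Unicellular U

  pattern old d = suc (suc (suc (suc (suc (suc d)))))

  module Insertion (p q r : Fin n) (X Y Z Q : List (Fin n))
    (W≡ : W ≡ X ++ p ∷ Y ++ q ∷ Z ++ r ∷ Q) where

    o : Fin n → Fin (6 + n)
    o = 6 ↑ʳ_

    o-inj : Injective _≡_ _≡_ o
    o-inj = ↑ʳ-injective 6 _ _

    W-segments : W ≡ (X ++ [ p ]) ++ (Y ++ [ q ]) ++ (Z ++ [ r ]) ++ Q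
    W-segments = trans W≡ (sym (trans (++-assoc X [ p ] _) (cong (λ L → X ++ p ∷ L)
      (trans (++-assoc Y [ q ] _) (cong (λ L → Y ++ q ∷ L) (++-assoc Z [ r ] Q))))))

    W-↭ : W ↭ p ∷ q ∷ r ∷ X ++ Y ++ Z ++ Q
    W-↭ = ↭-trans (↭-reflexive W≡) (gather p q r X Y Z Q)

    distinct : Unique (p ∷ q ∷ r ∷ X ++ Y ++ Z ++ Q)
    distinct = Unique-resp-↭ W-↭ unique

    p≢q : p ≢ q
    p≢q with (ne ∷ _) ∷ _ ← distinct = ne

    p≢r : p ≢ r
    p≢r with (_ ∷ ne ∷ _) ∷ _ ← distinct = ne

    q≢r : q ≢ r
    q≢r with _ ∷ (ne ∷ _) ∷ _ ← distinct = ne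

    corner-∈ : ∀ {d} → d ∈ p ∷ q ∷ r ∷ [] → d ∈ W
    corner-∈ i = ∈-resp-↭ (↭-sym W-↭) (∈-++⁺ˡ i)

    data Corner (d : Fin n) : Set where
      isP : d ≡ p → Corner d
      isQ : d ≡ q → Corner d
      isR : d ≡ r → Corner d
      none : d ≢ p → d ≢ q → d ≢ r → Corner d

    corner? : ∀ d → Corner d
    corner? d with d ≟ p | d ≟ q | d ≟ r
    ... | yes eq | _ | _ = isP eq
    ... | no _ | yes eq | _ = isQ eq
    ... | no _ | no _ | yes eq = isR eq
    ... | no np | no nq | no nr = none np nq nr

    redirect : ∀ d → Corner d → Fin (6 + n)
    redirect d (isP _) = 0F
    redirect d (isQ _) = 4F
    redirect d (isR _) = 2F
    redirect d (none _ _ _) = o (τ d)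

    -- After `p` and dart 0 the walk continues behind `q`, so the segments Yq and Zr change places
    -- within a single cycle. The opposite orientation would lead from `p` to behind `r`, from `q`
    -- to behind `p` and from `r` to behind `q`, cutting the outer walk into three.
    τ′ : Fin (6 + n) → Fin (6 + n)
    τ′ 0F = o (τ q)
    τ′ 1F = 3F
    τ′ 2F = o (τ p)
    τ′ 3F = 5F
    τ′ 4F = o (τ r)
    τ′ 5F = 1F
    τ′ (old d) = redirect d (corner? d)

    α′ : Fin (6 + n) → Fin (6 + n)
    α′ 0F = 1F
    α′ 1F = 0F
    α′ 2F = 3F
    α′ 3F = 2F
    α′ 4F = 5F
    α′ 5F = 4F
    α′ (old d) = o (α d)

    τ′-p : τ′ (o p) ≡ 0F
    τ′-p with corner? p
    ... | isP _ = refl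
    ... | isQ eq = ⊥-elim (p≢q eq)
    ... | isR eq = ⊥-elim (p≢r eq)
    ... | none ne _ _ = ⊥-elim (ne refl)

    τ′-q : τ′ (o q) ≡ 4F
    τ′-q with corner? q
    ... | isP eq = ⊥-elim (p≢q (sym eq))
    ... | isQ _ = refl
    ... | isR eq = ⊥-elim (q≢r eq)
    ... | none _ ne _ = ⊥-elim (ne refl)

    τ′-r : τ′ (o r) ≡ 2F
    τ′-r with corner? r
    ... | isP eq = ⊥-elim (p≢r (sym eq))
    ... | isQ eq = ⊥-elim (q≢r (sym eq))
    ... | isR _ = refl
    ... | none _ _ ne = ⊥-elim (ne refl)

    τ′-other : ∀ {d} → d ≢ p → d ≢ q → d ≢ r → τ′ (o d) ≡ o (τ d)
    τ′-other {d} np nq nr with corner? d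
    ... | isP eq = ⊥-elim (np eq)
    ... | isQ eq = ⊥-elim (nq eq)
    ... | isR eq = ⊥-elim (nr eq)
    ... | none _ _ _ = refl

    τ′-surjective : ∀ y → ∃ λ x → τ′ x ≡ y
    τ′-surjective 0F = o p , τ′-p
    τ′-surjective 1F = 5F , refl
    τ′-surjective 2F = o r , τ′-r
    τ′-surjective 3F = 1F , refl
    τ′-surjective 4F = o q , τ′-q
    τ′-surjective 5F = 3F , refl
    τ′-surjective (old y) with τ-surjective y
    ... | x , refl with corner? x
    ... | isP refl = 2F , refl
    ... | isQ refl = 0F , refl
    ... | isR refl = 4F , refl
    ... | none np nq nr = o x , τ′-other np nq nr

    τ′-inj : Injective _≡_ _≡_ τ′
    τ′-inj = surjective⇒injective {f = τ′} τ′-surjective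

    α′-invol : ∀ d → α′ (α′ d) ≡ d
    α′-invol 0F = refl
    α′-invol 1F = refl
    α′-invol 2F = refl
    α′-invol 3F = refl
    α′-invol 4F = refl
    α′-invol 5F = refl
    α′-invol (old d) = cong o (α-invol d)

    α′-free : ∀ d → α′ d ≢ d
    α′-free 0F ()
    α′-free 1F ()
    α′-free 2F ()
    α′-free 3F ()
    α′-free 4F ()
    α′-free 5F ()
    α′-free (old d) eq = α-free d (o-inj eq)

    v′ : Fin (6 + n) → Fin S
    v′ 0F = v (α p)
    v′ 1F = v (α q)
    v′ 2F = v (α r)
    v′ 3F = v (α p)
    v′ 4F = v (α q)
    v′ 5F = v (α r)
    v′ (old d) = v d

    v′-τ′ : ∀ d → v′ (τ′ d) ≡ v′ (α′ d)
    v′-τ′ 0F = v-τ q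
    v′-τ′ 1F = refl
    v′-τ′ 2F = v-τ p
    v′-τ′ 3F = refl
    v′-τ′ 4F = v-τ r
    v′-τ′ 5F = refl
    v′-τ′ (old d) with corner? d
    ... | isP refl = refl
    ... | isQ refl = refl
    ... | isR refl = refl
    ... | none _ _ _ = v-τ d

    ρ′ : Fin (6 + n) → Fin (6 + n)
    ρ′ = τ′ ∘ α′

    ρ′-inj : Injective _≡_ _≡_ ρ′
    ρ′-inj eq = rightInverse-injective {f = α′} {α′} α′-invol (τ′-inj eq)

    -- Each of the three corners receives two new darts, hence three steps instead of one.
    old-step : ∀ d → SameOrbit ρ′ (o d) (o (τ (α d)))
    old-step d with corner? (α d) in eq
    ... | isP refl = 3 , cong (ρ′ ∘ ρ′) (cong (redirect (α d)) eq)
    ... | isQ refl = 3 , cong (ρ′ ∘ ρ′) (cong (redirect (α d)) eq)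
    ... | isR refl = 3 , cong (ρ′ ∘ ρ′) (cong (redirect (α d)) eq)
    ... | none _ _ _ = 1 , cong (redirect (α d)) eq

    turn : ∀ {d e} → τ′ (o d) ≡ e → SameOrbit ρ′ (o (α d)) e
    turn {d} eq = 1 , trans (cong (τ′ ∘ o) (α-invol d)) eq

    anchor : ∀ x → ∃ λ d → v d ≡ v′ x × SameOrbit ρ′ (o d) x
    anchor 0F = α p , refl , turn τ′-p
    anchor 1F = α q , refl , orbit-trans (turn τ′-q) orbit-step
    anchor 2F = α r , refl , turn τ′-r
    anchor 3F = α p , refl , orbit-trans (turn τ′-p) orbit-step
    anchor 4F = α q , refl , turn τ′-q
    anchor 5F = α r , refl , orbit-trans (turn τ′-r) orbit-step
    anchor (old d) = d , refl , orbit-refl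

    v′-orbit : ∀ x y → v′ x ≡ v′ y → SameOrbit ρ′ x y
    v′-orbit x y eq with anchor x | anchor y
    ... | d , p , i | e , q , j = orbit-trans (orbit-sym ρ′-inj i)
      (orbit-trans (orbit-map o old-step (v-orbit d e (trans p (trans eq (sym q))))) j)

    W′ : List (Fin (6 + n))
    W′ = map o (X ++ [ p ]) ++ 0F ∷ map o (Z ++ [ r ]) ++ 2F ∷ map o (Y ++ [ q ]) ++ 4F ∷ map o Q

    W′-↭ : W′ ↭ 0F ∷ 2F ∷ 4F ∷ map o W
    W′-↭ = ↭-trans (gather 0F 2F 4F A (map o (Z ++ [ r ])) B (map o Q))
      (prep 0F (prep 2F (prep 4F (↭-trans (++⁺ˡ A (shifts (map o (Z ++ [ r ])) B))
        (↭-reflexive (sym (trans (cong (map o) W-segments) (trans (map-++ o (X ++ [ p ]) _) (cong (A ++_)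
          (trans (map-++ o (Y ++ [ q ]) _) (cong (B ++_) (map-++ o (Z ++ [ r ]) Q))))))))))))
      where
      A = map o (X ++ [ p ])
      B = map o (Y ++ [ q ])

    regular : ∀ {d} → d ∈ X ++ Y ++ Z ++ Q → τ′ (o d) ≡ o (τ d)
    regular i with (_ ∷ _ ∷ ps) ∷ (_ ∷ qs) ∷ rs ∷ _ ← distinct =
      τ′-other (All.lookup ps i ∘ sym) (All.lookup qs i ∘ sym) (All.lookup rs i ∘ sym)

    -- The equation `τ d ≡ y` identifies the start of the following segment with the place where a
    -- new dart re-enters the old walk.
    segment : ∀ {x y d e} L → (∀ {c} → c ∈ L → c ∈ X ++ Y ++ Z ++ Q) → τ′ (o d) ≡ e →
      Walk τ x (L ++ [ d ]) y → Walk τ′ (o x) (map o (L ++ [ d ])) e × τ d ≡ y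
    segment {x} {d = d} L sub refl w with walk-last L w
    ... | w₁ , eq = subst (λ M → Walk τ′ (o x) M _) (sym (map-++ o L [ d ]))
      (walk-++ (walk-map o (regular ∘ sub) w₁) (step [])) , eq

    walk′ : Walk τ′ (o start) W′ (o start)
    walk′ with walk-split (X ++ [ p ]) (subst (λ L → Walk τ start L start) W-segments walk)
    ... | _ , wX , w with walk-split (Y ++ [ q ]) w
    ... | _ , wY , w with walk-split (Z ++ [ r ]) w
    ... | _ , wZ , wQ
      with segment X ∈-++⁺ˡ τ′-p wX
         | segment Y (∈-++⁺ʳ X ∘ ∈-++⁺ˡ) τ′-q wY
         | segment Z (∈-++⁺ʳ X ∘ ∈-++⁺ʳ Y ∘ ∈-++⁺ˡ) τ′-r wZ
    ... | X′ , refl | Y′ , refl | Z′ , refl =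
      walk-++ X′ (step (walk-++ Z′ (step (walk-++ Y′ (step
        (walk-map o (regular ∘ ∈-++⁺ʳ X ∘ ∈-++⁺ʳ Y ∘ ∈-++⁺ʳ Z) wQ))))))

    unique′ : Unique W′
    unique′ = Unique-resp-↭ (↭-sym W′-↭)
      (((λ ()) ∷ (λ ()) ∷ Allₚ.map⁺ (All.universal (λ _ ()) W))
      ∷ ((λ ()) ∷ Allₚ.map⁺ (All.universal (λ _ ()) W))
      ∷ Allₚ.map⁺ (All.universal (λ _ ()) W)
      ∷ Uniqueₚ.map⁺ o-inj unique)

    -- The outer face must keep label 0, so the new face takes label 1 and `punchIn 1F` moves the
    -- other inner labels up.
    f′ : Fin (6 + n) → Fin (2 + T)
    f′ 0F = 0F
    f′ 1F = 1F
    f′ 2F = 0F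
    f′ 3F = 1F
    f′ 4F = 0F
    f′ 5F = 1F
    f′ (old d) = punchIn 1F (f d)

    punchIn-zero : ∀ {i : Fin (suc T)} → punchIn 1F i ≡ zero → i ≡ zero
    punchIn-zero {zero} _ = refl

    old-∈ : ∀ {d} → d ∈ W → o d ∈ W′
    old-∈ i = ∈-resp-↭ (↭-sym W′-↭) (there (there (there (∈-map⁺ o i))))

    W′-outer : ∀ {d} → d ∈ W′ → f′ d ≡ zero
    W′-outer i with ∈-resp-↭ W′-↭ i
    ... | here refl = refl
    ... | there (here refl) = refl
    ... | there (there (here refl)) = refl
    ... | there (there (there j)) with ∈-map⁻ o j
    ... | e , e∈ , refl = cong (punchIn 1F) (W-outer e∈)

    outer-W′ : ∀ {d} → f′ d ≡ zero → d ∈ W′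
    outer-W′ {0F} _ = ∈-resp-↭ (↭-sym W′-↭) (here refl)
    outer-W′ {2F} _ = ∈-resp-↭ (↭-sym W′-↭) (there (here refl))
    outer-W′ {4F} _ = ∈-resp-↭ (↭-sym W′-↭) (there (there (here refl)))
    outer-W′ {old d} eq = old-∈ (outer-W (punchIn-zero eq))

    corner-outer : ∀ {d} → d ∈ p ∷ q ∷ r ∷ [] → f d ≡ zero
    corner-outer = W-outer ∘ corner-∈

    p-outer : f p ≡ zero
    p-outer = corner-outer (here refl)

    q-outer : f q ≡ zero
    q-outer = corner-outer (there (here refl))

    r-outer : f r ≡ zero
    r-outer = corner-outer (there (there (here refl)))

    f′-τ′ : ∀ d → f′ (τ′ d) ≡ f′ d
    f′-τ′ 0F = cong (punchIn 1F) (trans (f-τ q) q-outer)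
    f′-τ′ 1F = refl
    f′-τ′ 2F = cong (punchIn 1F) (trans (f-τ p) p-outer)
    f′-τ′ 3F = refl
    f′-τ′ 4F = cong (punchIn 1F) (trans (f-τ r) r-outer)
    f′-τ′ 5F = refl
    f′-τ′ (old d) with corner? d
    ... | isP refl = sym (cong (punchIn 1F) p-outer)
    ... | isQ refl = sym (cong (punchIn 1F) q-outer)
    ... | isR refl = sym (cong (punchIn 1F) r-outer)
    ... | none _ _ _ = cong (punchIn 1F) (f-τ d)

    inner-iter : ∀ k {d} → f d ≢ zero → iter τ′ k (o d) ≡ o (iter τ k d)
    inner-iter zero ne = refl
    inner-iter (suc k) {d} ne = trans (cong τ′ (inner-iter k ne))
      (τ′-other (away p-outer) (away q-outer) (away r-outer))
      where
      away : ∀ {e} → f e ≡ zero → iter τ k d ≢ e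
      away e-outer eq = ne (trans (orbit-invariant f f-τ (k , refl)) (trans (cong f eq) e-outer))

    -- Reduces `f′-orbit` from seven kinds of dart on each side to three.
    data Origin : Fin (6 + n) → Set where
      outside : ∀ {x} → f′ x ≡ zero → Origin x
      triangle : ∀ {x} → f′ x ≡ 1F → SameOrbit τ′ 1F x → Origin x
      former : ∀ d → Origin (o d)

    origin : ∀ x → Origin x
    origin 0F = outside refl
    origin 1F = triangle refl orbit-refl
    origin 2F = outside refl
    origin 3F = triangle refl orbit-step
    origin 4F = outside refl
    origin 5F = triangle refl (2 , refl)
    origin (old d) = former d

    f′-orbit : ∀ x y → f′ x ≡ f′ y → f′ x ≢ zero → SameOrbit τ′ x y
    f′-orbit x y eq ne with origin x | origin y
    ... | outside z | _ = ⊥-elim (ne z)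
    ... | triangle _ _ | outside z = ⊥-elim (ne (trans eq z))
    ... | former _ | outside z = ⊥-elim (ne (trans eq z))
    ... | triangle _ i | triangle _ j = orbit-trans (orbit-sym τ′-inj i) j
    ... | triangle z _ | former e = ⊥-elim (punchInᵢ≢i 1F (f e) (trans (sym eq) z))
    ... | former d | triangle z _ = ⊥-elim (punchInᵢ≢i 1F (f d) (trans eq z))
    ... | former d | former e with f-orbit d e (punchIn-injective 1F _ _ eq) (ne ∘ cong (punchIn 1F))
    ... | k , i = k , trans (inner-iter k (ne ∘ cong (punchIn 1F))) (cong o i)

    f′-surjective : ∀ i → ∃ λ d → f′ d ≡ i
    f′-surjective 0F = 0F , refl
    f′-surjective 1F = 1F , refl
    f′-surjective (suc (suc i)) with f-surjective (suc i)
    ... | d , eq = o d , cong (punchIn 1F) eq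

    complete′ : ∀ d → f′ d ≡ zero ⊎ f′ (α′ d) ≡ zero
    complete′ 0F = inj₁ refl
    complete′ 1F = inj₂ refl
    complete′ 2F = inj₁ refl
    complete′ 3F = inj₂ refl
    complete′ 4F = inj₁ refl
    complete′ 5F = inj₂ refl
    complete′ (old d) = Sum.map (cong (punchIn 1F)) (cong (punchIn 1F)) (complete d)

    insert : Unicellular S (suc T)
    insert = record
      { n = 6 + n ; τ = τ′ ; α = α′ ; τ-surjective = τ′-surjective
      ; α-invol = α′-invol ; α-free = α′-free
      ; v = v′ ; v-τ = v′-τ′ ; v-orbit = v′-orbit
      ; start = o start ; W = W′ ; walk = walk′ ; unique = unique′
      ; f = f′ ; W-outer = W′-outer ; outer-W = outer-W′ ; f-τ = f′-τ′ ; f-orbit = f′-orbit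
      ; f-surjective = f′-surjective
      ; complete = complete′
      ; heads = λ s → o (proj₁ (heads s)) , old-∈ (proj₁ (proj₂ (heads s))) , proj₂ (proj₂ (heads s))
      ; n-count = trans (arith₁ n) (trans (cong (6 +_) n-count) (arith₂ S T))
      }
      where
      arith₁ : ∀ n → 2 + (6 + n) ≡ 6 + (2 + n)
      arith₁ = solve-∀
      arith₂ : ∀ s t → 6 + (s + s + 6 * t) ≡ s + s + 6 * (1 + t)
      arith₂ = solve-∀

    keeps-joined : ∀ {s t} → Joined s t → Unicellular.Joined insert s t
    keeps-joined (d , i , j) = o d , i , j

    joins : ∀ {d e} → d ∈ p ∷ q ∷ r ∷ [] → e ∈ p ∷ q ∷ r ∷ [] → d ≢ e →
      Unicellular.Joined insert (v (α d)) (v (α e))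
    joins (here refl) (here refl) ne = ⊥-elim (ne refl)
    joins (here refl) (there (here refl)) ne = 0F , refl , refl
    joins (here refl) (there (there (here refl))) ne = 3F , refl , refl
    joins (there (here refl)) (here refl) ne = 1F , refl , refl
    joins (there (here refl)) (there (here refl)) ne = ⊥-elim (ne refl)
    joins (there (here refl)) (there (there (here refl))) ne = 4F , refl , refl
    joins (there (there (here refl))) (here refl) ne = 2F , refl , refl
    joins (there (there (here refl))) (there (here refl)) ne = 5F , refl , refl
    joins (there (there (here refl))) (there (there (here refl))) ne = ⊥-elim (ne refl)

-- The order in which `x`, `y`, `z` occur along `L` is not under control; `p`, `q`, `r` are the same
-- elements as they come. This is harmless, because the triangle joins all three pairs.
record Corners {A : Set} (L : List A) (x y z : A) : Set where
  field
    p q r : A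
    X Y Z Q : List A
    decompose : L ≡ X ++ p ∷ Y ++ q ∷ Z ++ r ∷ Q
    x∈ : x ∈ p ∷ q ∷ r ∷ []
    y∈ : y ∈ p ∷ q ∷ r ∷ []
    z∈ : z ∈ p ∷ q ∷ r ∷ []

∈-split : {A : Set} {x y : A} (xs : List A) {ys : List A} → y ≢ x → y ∈ xs ++ x ∷ ys → y ∈ xs ⊎ y ∈ ys
∈-split xs ne i with ∈-++⁻ xs i
... | inj₁ j = inj₁ j
... | inj₂ (here eq) = ⊥-elim (ne eq)
... | inj₂ (there j) = inj₂ j

∈-split₂ : {A : Set} {y z : A} {L : List A} → y ≢ z → y ∈ L → z ∈ L →
  ∃ λ B → ∃ λ C → ∃ λ D → L ≡ B ++ y ∷ C ++ z ∷ D ⊎ L ≡ B ++ z ∷ C ++ y ∷ D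
∈-split₂ {y = y} {z} ne i j with ∈-∃++ i
... | B , C , refl with ∈-split B (ne ∘ sym) j
... | inj₁ k with ∈-∃++ k
... | B₁ , B₂ , refl = B₁ , B₂ , C , inj₂ (++-assoc B₁ (z ∷ B₂) (y ∷ C))
∈-split₂ ne i j | B , C , refl | inj₂ k with ∈-∃++ k
... | C₁ , C₂ , refl = B , C₁ , C₂ , inj₁ refl

corners : {A : Set} {L : List A} {x y z : A} → x ≢ y → x ≢ z → y ≢ z →
  x ∈ L → y ∈ L → z ∈ L → Corners L x y z
corners {x = x} {y} {z} xy xz yz x∈ y∈ z∈ with ∈-∃++ x∈
... | B , C , refl with ∈-split B (xy ∘ sym) y∈ | ∈-split B (xz ∘ sym) z∈
... | inj₁ i | inj₂ j with ∈-∃++ i | ∈-∃++ j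
... | B₁ , B₂ , refl | C₁ , C₂ , refl = record
  { decompose = ++-assoc B₁ (y ∷ B₂) _
  ; x∈ = there (here refl) ; y∈ = here refl ; z∈ = there (there (here refl)) }
corners {x = x} {y} {z} xy xz yz x∈ y∈ z∈ | B , C , refl | inj₂ i | inj₁ j with ∈-∃++ i | ∈-∃++ j
... | C₁ , C₂ , refl | B₁ , B₂ , refl = record
  { decompose = ++-assoc B₁ (z ∷ B₂) _
  ; x∈ = there (here refl) ; y∈ = there (there (here refl)) ; z∈ = here refl }
corners {x = x} {y} {z} xy xz yz x∈ y∈ z∈ | B , C , refl | inj₁ i | inj₁ j with ∈-split₂ yz i j
... | B₁ , B₂ , B₃ , inj₁ refl = record
  { decompose = trans (++-assoc B₁ (y ∷ B₂ ++ z ∷ B₃) _) (cong (λ L → B₁ ++ y ∷ L) (++-assoc B₂ (z ∷ B₃) _))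
  ; x∈ = there (there (here refl)) ; y∈ = here refl ; z∈ = there (here refl) }
... | B₁ , B₂ , B₃ , inj₂ refl = record
  { decompose = trans (++-assoc B₁ (z ∷ B₂ ++ y ∷ B₃) _) (cong (λ L → B₁ ++ z ∷ L) (++-assoc B₂ (y ∷ B₃) _))
  ; x∈ = there (there (here refl)) ; y∈ = there (here refl) ; z∈ = here refl }
corners {x = x} {y} {z} xy xz yz x∈ y∈ z∈ | B , C , refl | inj₂ i | inj₂ j with ∈-split₂ yz i j
... | C₁ , C₂ , C₃ , inj₁ refl = record
  { decompose = refl ; x∈ = here refl ; y∈ = there (here refl) ; z∈ = there (there (here refl)) }
... | C₁ , C₂ , C₃ , inj₂ refl = record
  { decompose = refl ; x∈ = here refl ; y∈ = there (there (here refl)) ; z∈ = there (here refl) }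

record Triple (A : Set) : Set where
  constructor triple
  field
    a b c : A
    a≢b : a ≢ b
    a≢c : a ≢ c
    b≢c : b ≢ c

record Covers {S T : ℕ} (U : Unicellular S T) (t : Triple (Fin S)) : Set where
  open Triple t
  open Unicellular U
  field
    ab : Joined a b
    ac : Joined a c
    bc : Joined b c

addTriangle : ∀ {S T} (U : Unicellular S T) (t : Triple (Fin S)) → ∃ λ (U′ : Unicellular S (suc T)) →
  (∀ {s t} → Unicellular.Joined U s t → Unicellular.Joined U′ s t) × Covers U′ t
addTriangle U (triple a b c a≢b a≢c b≢c) with Unicellular.heads U a | Unicellular.heads U b | Unicellular.heads U c
... | x , x∈W , refl | y , y∈W , refl | z , z∈W , refl =
    insert , keeps-joined
  , record { ab = joins x∈ y∈ x≢y ; ac = joins x∈ z∈ x≢z ; bc = joins y∈ z∈ y≢z }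
  where
  open Unicellular U
  x≢y : x ≢ y
  x≢y = a≢b ∘ cong (v ∘ α)
  x≢z : x ≢ z
  x≢z = a≢c ∘ cong (v ∘ α)
  y≢z : y ≢ z
  y≢z = b≢c ∘ cong (v ∘ α)
  open Corners (corners x≢y x≢z y≢z x∈W y∈W z∈W)
  open Triangle.Insertion U p q r X Y Z Q decompose

triangles : ∀ {j} (ts : List (Triple (Fin (2 + j)))) → ∃ λ (U : Unicellular (2 + j) (length ts)) → All (Covers U) ts
triangles {j} [] = tree j , []
triangles (t ∷ ts) with triangles ts
... | U , cs with addTriangle U t
... | U′ , keeps , c = U′ , c ∷ All.map (λ c → let open Covers c in
  record { ab = keeps ab ; ac = keeps ac ; bc = keeps bc }) cs

-- From labelled maps to combinatorial maps

module ToMap {j T : ℕ} (U : Unicellular (2 + j) T) where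
  open Unicellular U

  private
    S : ℕ
    S = 2 + j

  τ⁻ : Fin n → Fin n
  τ⁻ d = proj₁ (τ-surjective d)

  rot-inverseˡ : ∀ d → τ (α (α (τ⁻ d))) ≡ d
  rot-inverseˡ d = trans (cong τ (α-invol _)) (proj₂ (τ-surjective d))

  Step : Fin n → Fin n → Set
  Step a b = b ≡ τ (α a) ⊎ b ≡ α a

  τ-path : ∀ {x y} → SameOrbit τ x y → Star Step x y
  τ-path (zero , refl) = ε
  τ-path {x} (suc k , refl) = τ-path (k , refl) ◅◅ inj₂ refl ◅ inj₁ (cong τ (sym (α-invol _))) ◅ ε

  outer-orbit : ∀ {d} → f d ≡ zero → SameOrbit τ start d
  outer-orbit eq = walk-orbit walk (outer-W eq)

  -- Every dart or its reverse lies on the outer walk, so completeness already gives connectedness.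
  connected : ∀ x y → Star Step x y
  connected x y = toStart (complete x) ◅◅ fromStart (complete y)
    where
    toStart : f x ≡ zero ⊎ f (α x) ≡ zero → Star Step x start
    toStart (inj₁ eq) = τ-path (orbit-sym τ-inj (outer-orbit eq))
    toStart (inj₂ eq) = inj₂ refl ◅ τ-path (orbit-sym τ-inj (outer-orbit eq))
    fromStart : f y ≡ zero ⊎ f (α y) ≡ zero → Star Step start y
    fromStart (inj₁ eq) = τ-path (outer-orbit eq)
    fromStart (inj₂ eq) = τ-path (outer-orbit eq) ◅◅ inj₂ (sym (α-invol y)) ◅ ε

  toMap : Map
  toMap = record
    { darts = n
    ; σ = permutation (τ ∘ α) (α ∘ τ⁻) rot-inverseˡ (rightInverse⇒leftInverse {f = τ ∘ α} {α ∘ τ⁻} rot-inverseˡ)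
    ; α = α ; α-invol = α-invol ; α-free = α-free ; connected = connected
    }

  rot-inj : Injective _≡_ _≡_ (τ ∘ α)
  rot-inj = α-inj ∘ τ-inj

  module Vertices = OrbitLabels rot-inj v (λ d → trans (v-τ (α d)) (cong v (α-invol d))) v-orbit
    (λ s → α (proj₁ (heads s)) , proj₂ (proj₂ (heads s)))

  vertices : Map.NumVertices toMap S
  vertices = Vertices.card-orbits

  -- The rotation is `τ ∘ α`, so the left-walk permutation of `toMap` is `τ ∘ α ∘ α`, equal to `τ`
  -- only pointwise.
  τ≗ : ∀ d → τ d ≡ Map.τ toMap d
  τ≗ d = cong τ (sym (α-invol d))

  faces : Map.NumFaces toMap (suc T)
  faces = OrbitLabels.card-orbits (λ eq → τ-inj (trans (τ≗ _) (trans eq (sym (τ≗ _)))))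
    f (λ d → trans (cong f (sym (τ≗ d))) (f-τ d)) (λ x y eq → orbit-≗ τ≗ (same x y eq)) f-surjective
    where
    same : ∀ x y → f x ≡ f y → SameOrbit τ x y
    same x y eq with f x ≟ zero
    ... | yes z = orbit-trans (orbit-sym τ-inj (outer-orbit z)) (outer-orbit (trans (sym eq) z))
    ... | no nz = f-orbit x y eq nz

  cellularGenus : Map.CellularGenus toMap T
  cellularGenus = S , suc T , E , ℕₚ.+-cancelˡ-≡ 2 _ _ (trans n-count (arith₁ j T)) , vertices , faces , arith₂ j T
    where
    E : ℕ
    E = suc j + 3 * T
    arith₁ : ∀ j t → 2 + j + (2 + j) + 6 * t ≡ 2 + ((1 + j + 3 * t) + (1 + j + 3 * t))
    arith₁ = solve-∀
    arith₂ : ∀ j t → 2 + j + (1 + t) + 2 * t ≡ 2 + (1 + j + 3 * t)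
    arith₂ = solve-∀

  completeLeftWalk : Map.HasCompleteLeftWalk toMap
  completeLeftWalk = start , λ d → Sum.map (orbit-≗ τ≗ ∘ outer-orbit) (orbit-≗ τ≗ ∘ outer-orbit) (complete d)

  reducedEdges : ∃ (Map.ReducedEdges toMap)
  reducedEdges = card-Fin² λ (x , y) → orbitMin? rot-inj x ×-dec orbitMin? rot-inj y ×-dec (toℕ x ℕₚ.<? toℕ y)
    ×-dec any? (λ d → orbit? rot-inj x d ×-dec orbit? rot-inj y (α d))

  module _ {A : ℕ} (joined : Map.ReducedEdges toMap A) where
    open CardOf joined
    open Vertices using (representative; ℓ-representative; representative-min)

    joinedPair : ∀ {s t} → toℕ (representative s) < toℕ (representative t) → Joined s t →
      Map.JoinedPair toMap (representative s , representative t)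
    joinedPair {s} {t} lt (d , p , q) = representative-min s , representative-min t , lt
      , d , v-orbit _ _ (trans (ℓ-representative s) (sym p)) , v-orbit _ _ (trans (ℓ-representative t) (sym q))

    representative-injective : ∀ {s t} → representative s ≡ representative t → s ≡ t
    representative-injective {s} {t} eq = trans (sym (ℓ-representative s)) (trans (cong v eq) (ℓ-representative t))

    data PairIndex (s t : Fin S) : Fin A ⊎ Fin A → Set where
      forward : ∀ {i} → elem i ≡ (representative s , representative t) → PairIndex s t (inj₁ i)
      backward : ∀ {i} → elem i ≡ (representative t , representative s) → PairIndex s t (inj₂ i)

    pairIndex : ∀ {s t} → s ≢ t → Joined s t → ∃ (PairIndex s t)
    pairIndex {s} {t} ne jn with ℕₚ.<-cmp (toℕ (representative s)) (toℕ (representative t))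
    ... | tri< lt _ _ = _ , forward (elem-index (joinedPair lt jn))
    ... | tri≈ _ eq _ = ⊥-elim (ne (representative-injective (toℕ-injective eq)))
    ... | tri> _ _ gt = _ , backward (elem-index (joinedPair gt (Joined-sym jn)))

    pairIndex-injective : ∀ {s t s' t' i} → PairIndex s t i → PairIndex s' t' i → (s , t) ≡ (s' , t')
    pairIndex-injective (forward p) (forward q) with trans (sym p) q
    ... | eq = cong₂ _,_ (representative-injective (cong proj₁ eq)) (representative-injective (cong proj₂ eq))
    pairIndex-injective (backward p) (backward q) with trans (sym p) q
    ... | eq = cong₂ _,_ (representative-injective (cong proj₂ eq)) (representative-injective (cong proj₁ eq))

    -- Each unordered joined pair is counted in both orders.
    joined-≤ : {B : Set} {m : ℕ} → Fin m ↔ B → (e : B → Fin S × Fin S) → Injective _≡_ _≡_ e →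
      (∀ b → proj₁ (e b) ≢ proj₂ (e b)) → (∀ b → Joined (proj₁ (e b)) (proj₂ (e b))) → m ≤ A + A
    joined-≤ m↔B e e-inj distinct jn = ≤-from-injection m↔B (fin⊎ (↔-id _) (↔-id _))
      (λ b → proj₁ (idx b))
      (λ {b} {b'} eq → e-inj (pairIndex-injective (proj₂ (idx b)) (subst (PairIndex _ _) (sym eq) (proj₂ (idx b')))))
      where
      idx : ∀ b → ∃ (PairIndex (proj₁ (e b)) (proj₂ (e b)))
      idx b = pairIndex (distinct b) (jn b)

-- Addition modulo m and the Bose triples

module _ {m' : ℕ} where
  private
    m : ℕ
    m = suc m'

  _⊕_ : Fin m → Fin m → Fin m
  x ⊕ y = fromℕ< (m%n<n (toℕ x + toℕ y) m)

  ⊕-comm : ∀ x y → x ⊕ y ≡ y ⊕ x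
  ⊕-comm x y = toℕ-injective (trans (toℕ-fromℕ< (m%n<n (toℕ x + toℕ y) m))
    (trans (cong (_% m) (ℕₚ.+-comm (toℕ x) (toℕ y))) (sym (toℕ-fromℕ< (m%n<n (toℕ y + toℕ x) m)))))

  ⊕-retract : ∀ x y → (m ∸ toℕ x + toℕ (x ⊕ y)) % m ≡ toℕ y
  ⊕-retract x y = begin
    (m ∸ toℕ x + toℕ (x ⊕ y)) % m ≡⟨ cong (λ z → (m ∸ toℕ x + z) % m) (toℕ-fromℕ< (m%n<n (toℕ x + toℕ y) m)) ⟩
    (m ∸ toℕ x + (toℕ x + toℕ y) % m) % m ≡⟨ %-distribˡ-+ (m ∸ toℕ x) _ m ⟩
    ((m ∸ toℕ x) % m + ((toℕ x + toℕ y) % m) % m) % m ≡⟨ cong (λ z → ((m ∸ toℕ x) % m + z) % m) (m%n%n≡m%n (toℕ x + toℕ y) m) ⟩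
    ((m ∸ toℕ x) % m + (toℕ x + toℕ y) % m) % m ≡⟨ %-distribˡ-+ (m ∸ toℕ x) (toℕ x + toℕ y) m ⟨
    (m ∸ toℕ x + (toℕ x + toℕ y)) % m ≡⟨ cong (_% m) (ℕₚ.+-assoc (m ∸ toℕ x) (toℕ x) (toℕ y)) ⟨
    (m ∸ toℕ x + toℕ x + toℕ y) % m ≡⟨ cong (λ z → (z + toℕ y) % m) (ℕₚ.m∸n+n≡m (ℕₚ.<⇒≤ (toℕ<n x))) ⟩
    (m + toℕ y) % m ≡⟨ cong (_% m) (ℕₚ.+-comm m (toℕ y)) ⟩
    (toℕ y + m) % m ≡⟨ [m+n]%n≡m%n (toℕ y) m ⟩
    toℕ y % m ≡⟨ m<n⇒m%n≡m (toℕ<n y) ⟩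
    toℕ y ∎
    where open ≡-Reasoning

  ⊕-cancelˡ : ∀ x {y z} → x ⊕ y ≡ x ⊕ z → y ≡ z
  ⊕-cancelˡ x {y} {z} eq = toℕ-injective (trans (sym (⊕-retract x y))
    (trans (cong (λ w → (m ∸ toℕ x + toℕ w) % m) eq) (⊕-retract x z)))

next : Fin 3 → Fin 3
next 0F = 1F
next 1F = 2F
next 2F = 0F

next≢ : ∀ i → next i ≢ i
next≢ 0F ()
next≢ 1F ()
next≢ 2F ()

next²≢ : ∀ i → next (next i) ≢ i
next²≢ 0F ()
next²≢ 1F ()
next²≢ 2F ()

Distinct : ℕ → Set
Distinct m = ∃ λ ((x , y) : Fin m × Fin m) → x ≢ y

pairs : ∀ m → List (Distinct m)
pairs zero = []
pairs (suc m) = map (λ y → (zero , suc y) , λ ()) (allFin m)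
  ++ map (λ ((x , y) , ne) → (suc x , suc y) , ne ∘ suc-injective) (pairs m)

length-pairs : ∀ m → 2 * length (pairs (suc m)) ≡ suc m * m
length-pairs zero = refl
length-pairs (suc m) = begin
  2 * length (pairs (2 + m)) ≡⟨ cong (2 *_) (trans (length-++ (map _ (allFin (suc m))))
    (cong₂ _+_ (trans (length-map _ (allFin (suc m))) (length-tabulate {n = suc m} id)) (length-map _ (pairs (suc m))))) ⟩
  2 * (suc m + length (pairs (suc m))) ≡⟨ ℕₚ.*-distribˡ-+ 2 (suc m) _ ⟩
  2 * suc m + 2 * length (pairs (suc m)) ≡⟨ cong (2 * suc m +_) (length-pairs m) ⟩
  2 * suc m + suc m * m ≡⟨ arith m ⟩
  (2 + m) * suc m ∎
  where
  open ≡-Reasoning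
  arith : ∀ m → 2 * (1 + m) + (1 + m) * m ≡ (2 + m) * (1 + m)
  arith = solve-∀

∈-pairs : ∀ {m} (x y : Fin m) → x ≢ y →
  (∃ λ ne → ((x , y) , ne) ∈ pairs m) ⊎ (∃ λ ne → ((y , x) , ne) ∈ pairs m)
∈-pairs zero zero ne = ⊥-elim (ne refl)
∈-pairs zero (suc y) ne = inj₁ (_ , ∈-++⁺ˡ (∈-map⁺ _ (∈-allFin y)))
∈-pairs (suc x) zero ne = inj₂ (_ , ∈-++⁺ˡ (∈-map⁺ _ (∈-allFin x)))
∈-pairs {suc m} (suc x) (suc y) ne with ∈-pairs x y (ne ∘ cong suc)
... | inj₁ (_ , i) = inj₁ (_ , ∈-++⁺ʳ (map _ (allFin m)) (∈-map⁺ _ i))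
... | inj₂ (_ , i) = inj₂ (_ , ∈-++⁺ʳ (map _ (allFin m)) (∈-map⁺ _ i))

length-cartesianProductWith : {A B C : Set} (h : A → B → C) (xs : List A) (ys : List B) →
  length (cartesianProductWith h xs ys) ≡ length xs * length ys
length-cartesianProductWith h [] ys = refl
length-cartesianProductWith h (x ∷ xs) ys = trans (length-++ (map (h x) ys))
  (cong₂ _+_ (length-map (h x) ys) (length-cartesianProductWith h xs ys))

-- The Bose construction on Z/m × Z/3: the triples {(x , i), (y , i), (x + y , i + 1)}.
module Bose (m' : ℕ) where

  m : ℕ
  m = suc m'

  vertex : Fin m × Fin 3 → Fin (m * 3)
  vertex = uncurry combine

  vertex-injective : Injective _≡_ _≡_ vertex
  vertex-injective {x , i} {y , k} eq = cong₂ _,_ (combine-injectiveˡ x i y k eq) (combine-injectiveʳ x i y k eq)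

  -- Commutativity and cancellation of `⊕` make the triples cover no pair twice. As `⊕` is not
  -- idempotent, they miss the 3m pairs {(x , i), (x + x , i + 1)}, a negligible loss that leaves m
  -- arbitrary.
  bose : Distinct m → Fin 3 → Triple (Fin (m * 3))
  bose ((x , y) , ne) i = triple (vertex (x , i)) (vertex (y , i)) (vertex (x ⊕ y , next i))
    (λ eq → ne (cong proj₁ (vertex-injective {x , i} {y , i} eq)))
    (λ eq → next≢ i (sym (cong proj₂ (vertex-injective {x , i} {x ⊕ y , next i} eq))))
    (λ eq → next≢ i (sym (cong proj₂ (vertex-injective {y , i} {x ⊕ y , next i} eq))))

  boseTriples : List (Triple (Fin (m * 3)))
  boseTriples = cartesianProductWith bose (pairs m) (allFin 3)

  length-boseTriples : 2 * length boseTriples ≡ 3 * (m * m')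
  length-boseTriples = begin
    2 * length boseTriples ≡⟨ cong (2 *_) (length-cartesianProductWith bose (pairs m) (allFin 3)) ⟩
    2 * (length (pairs m) * 3) ≡⟨ ℕₚ.*-assoc 2 (length (pairs m)) 3 ⟨
    2 * length (pairs m) * 3 ≡⟨ cong (_* 3) (length-pairs m') ⟩
    m * m' * 3 ≡⟨ ℕₚ.*-comm (m * m') 3 ⟩
    3 * (m * m') ∎
    where open ≡-Reasoning

  module _ {T : ℕ} (U : Unicellular (m * 3) T) (covers : ∀ {t} → t ∈ boseTriples → Covers U t) where
    open Unicellular U using (Joined; Joined-sym)

    module _ {x y : Fin m} (i : Fin 3) (ne : x ≢ y) where

      joined-level : Joined (vertex (x , i)) (vertex (y , i))
      joined-level with ∈-pairs x y ne
      ... | inj₁ (_ , k) = Covers.ab (covers (∈-cartesianProductWith⁺ bose k (∈-allFin i)))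
      ... | inj₂ (_ , k) = Joined-sym (Covers.ab (covers (∈-cartesianProductWith⁺ bose k (∈-allFin i))))

      joined-next : Joined (vertex (x , i)) (vertex (x ⊕ y , next i))
      joined-next with ∈-pairs x y ne
      ... | inj₁ (_ , k) = Covers.ac (covers (∈-cartesianProductWith⁺ bose k (∈-allFin i)))
      ... | inj₂ (_ , k) = subst (λ z → Joined (vertex (x , i)) (vertex (z , next i))) (⊕-comm y x)
        (Covers.bc (covers (∈-cartesianProductWith⁺ bose k (∈-allFin i))))

    Index : Set
    Index = ((Fin m × Fin m') × Fin 3) × Fin 3

    -- `punchIn x y` runs over the elements other than `x`. Type 0 thus yields both orders of a pair
    -- within a level, while a pair in two levels needs type 1 for one order and type 2 for the
    -- other.
    ends : Index → (Fin m × Fin 3) × (Fin m × Fin 3)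
    ends (((x , y) , i) , 0F) = (x , i) , (punchIn x y , i)
    ends (((x , y) , i) , 1F) = (x , i) , (x ⊕ punchIn x y , next i)
    ends (((x , y) , i) , 2F) = (x ⊕ punchIn x y , next i) , (x , i)

    ends-joined : ∀ b → Joined (vertex (proj₁ (ends b))) (vertex (proj₂ (ends b)))
    ends-joined (((x , y) , i) , 0F) = joined-level i (punchInᵢ≢i x y ∘ sym)
    ends-joined (((x , y) , i) , 1F) = joined-next i (punchInᵢ≢i x y ∘ sym)
    ends-joined (((x , y) , i) , 2F) = Joined-sym (joined-next i (punchInᵢ≢i x y ∘ sym))

    ends-distinct : ∀ b → proj₁ (ends b) ≢ proj₂ (ends b)
    ends-distinct (((x , y) , i) , 0F) eq = punchInᵢ≢i x y (sym (cong proj₁ eq))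
    ends-distinct (((x , y) , i) , 1F) eq = next≢ i (sym (cong proj₂ eq))
    ends-distinct (((x , y) , i) , 2F) eq = next≢ i (cong proj₂ eq)

    next-determines : ∀ {x x' : Fin m} {y y' : Fin m'} {i i' : Fin 3} → (x ,′ i) ≡ (x' , i') →
      (x ⊕ punchIn x y ,′ next i) ≡ (x' ⊕ punchIn x' y' , next i') →
      ((x , y) , i) ≡ ((x' , y') , i')
    next-determines {x} {y = y} {y'} {i} refl eq = cong (λ z → (x , z) , i)
      (punchIn-injective x y y' (⊕-cancelˡ x (cong proj₁ eq)))

    level-determines : ∀ {x x' : Fin m} {y y' : Fin m'} {i i' : Fin 3} → (x ,′ i) ≡ (x' , i') →
      (punchIn x y ,′ i) ≡ (punchIn x' y' , i') → ((x , y) , i) ≡ ((x' , y') , i')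
    level-determines {x} {y = y} {y'} {i} refl eq = cong (λ z → (x , z) , i)
      (punchIn-injective x y y' (cong proj₁ eq))

    source-level : ∀ {b b'} → ends b ≡ ends b' → proj₂ (proj₁ (ends b)) ≡ proj₂ (proj₁ (ends b'))
    source-level = cong (proj₂ ∘ proj₁)

    target-level : ∀ {b b'} → ends b ≡ ends b' → proj₂ (proj₂ (ends b)) ≡ proj₂ (proj₂ (ends b'))
    target-level = cong (proj₂ ∘ proj₂)

    -- The levels tell the type: equal, one up, or one down modulo 3. These differ because neither
    -- `next` nor its square has a fixed point.
    ends-injective : ∀ b b' → ends b ≡ ends b' → b ≡ b'
    ends-injective (_ , 0F) (_ , 0F) eq = cong (_, 0F) (level-determines (cong proj₁ eq) (cong proj₂ eq))
    ends-injective (_ , 1F) (_ , 1F) eq = cong (_, 1F) (next-determines (cong proj₁ eq) (cong proj₂ eq))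
    ends-injective (_ , 2F) (_ , 2F) eq = cong (_, 2F) (next-determines (cong proj₂ eq) (cong proj₁ eq))
    ends-injective b@((_ , i) , 0F) b'@((_ , k) , 1F) eq =
      ⊥-elim (next≢ k (trans (sym (target-level {b} {b'} eq)) (source-level {b} {b'} eq)))
    ends-injective b@((_ , i) , 0F) b'@((_ , k) , 2F) eq =
      ⊥-elim (next≢ k (trans (sym (source-level {b} {b'} eq)) (target-level {b} {b'} eq)))
    ends-injective b@((_ , i) , 1F) b'@((_ , k) , 0F) eq =
      ⊥-elim (next≢ i (trans (target-level {b} {b'} eq) (sym (source-level {b} {b'} eq))))
    ends-injective b@((_ , i) , 2F) b'@((_ , k) , 0F) eq =
      ⊥-elim (next≢ i (trans (source-level {b} {b'} eq) (sym (target-level {b} {b'} eq))))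
    ends-injective b@((_ , i) , 1F) b'@((_ , k) , 2F) eq =
      ⊥-elim (next²≢ k (trans (cong next (sym (source-level {b} {b'} eq))) (target-level {b} {b'} eq)))
    ends-injective b@((_ , i) , 2F) b'@((_ , k) , 1F) eq =
      ⊥-elim (next²≢ i (trans (cong next (source-level {b} {b'} eq)) (sym (target-level {b} {b'} eq))))

    boseEdges : ∀ {A} → Map.ReducedEdges (ToMap.toMap U) A → m * m' * 3 * 3 ≤ A + A
    boseEdges joined = ToMap.joined-≤ U joined
      (fin× (fin× (fin× (↔-id _) (↔-id _)) (↔-id _)) (↔-id _))
      (λ b → vertex (proj₁ (ends b)) , vertex (proj₂ (ends b)))
      (λ {b} {b'} eq → ends-injective b b'
        (cong₂ _,_ (vertex-injective (cong proj₁ eq)) (vertex-injective (cong proj₂ eq))))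
      (λ b → ends-distinct b ∘ vertex-injective) ends-joined

  boseMap : ∀ g → 3 * (m * m') ≤ 2 * g → ∃ λ (M : Map) → ∃ λ A → Map.CellularGenus M g × Map.HasCompleteLeftWalk M
    × Map.NumVertices M (m * 3) × Map.ReducedEdges M A × m * m' * 3 * 3 ≤ A + A
  boseMap g le = subst (λ g → ∃ λ (M : Map) → ∃ λ A → Map.CellularGenus M g × Map.HasCompleteLeftWalk M
      × Map.NumVertices M (m * 3) × Map.ReducedEdges M A × m * m' * 3 * 3 ≤ A + A) length-padded
    (toMap , proj₁ reducedEdges , cellularGenus , completeLeftWalk , vertices , proj₂ reducedEdges
    , boseEdges (proj₁ built) (λ i → All.lookup (proj₂ built) (∈-++⁺ˡ i)) (proj₂ reducedEdges))
    where
    padded : List (Triple (Fin (m * 3)))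
    -- The genus is the number of triangles. Copies of one fixed triple bring it to exactly `g` and
    -- leave the pairs already joined intact.
    padded = boseTriples ++ replicate (g ∸ length boseTriples) (triple 0F 1F 2F (λ ()) (λ ()) (λ ()))
    length-padded : length padded ≡ g
    length-padded = trans (length-++ boseTriples) (trans (cong (length boseTriples +_) (length-replicate _))
      (ℕₚ.m+[n∸m]≡n (ℕₚ.*-cancelˡ-≤ {length boseTriples} {g} 2 (ℕₚ.≤-trans (ℕₚ.≤-reflexive length-boseTriples) le))))
    built : ∃ λ (U : Unicellular (m * 3) (length padded)) → All (Covers U) padded
    built = triangles padded
    open ToMap (proj₁ built)

-- Choice of the size and the asymptotic estimate

-- The largest size whose Bose triples number at most `g`. When `g` grows by one it moves up by at
-- most one, because `2 * g` grows by 2 and the thresholds are further apart.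
boseSize : ∀ g → ∃ λ m' → 3 * (suc m' * m') ≤ 2 * g × 2 * g < 3 * ((2 + m') * suc m')
boseSize zero = 0 , z≤n , s≤s z≤n
boseSize (suc g) with boseSize g
... | m' , lo , hi with 2 * suc g ℕₚ.<? 3 * ((2 + m') * suc m')
... | yes hi' = m' , ℕₚ.≤-trans lo (ℕₚ.*-monoʳ-≤ 2 (ℕₚ.n≤1+n g)) , hi'
... | no ≮ = suc m' , ℕₚ.≮⇒≥ ≮ , (begin-strict
  2 * suc g ≡⟨ ℕₚ.*-suc 2 g ⟩
  2 + 2 * g <⟨ ℕₚ.+-monoʳ-< 2 hi ⟩
  2 + 3 * ((2 + m') * suc m') ≤⟨ ℕₚ.m≤m+n _ (6 * m' + 10) ⟩
  2 + 3 * ((2 + m') * suc m') + (6 * m' + 10) ≡⟨ arith m' ⟩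
  3 * ((2 + suc m') * suc (suc m')) ∎)
  where
  open ℕₚ.≤-Reasoning
  arith : ∀ m → 2 + 3 * ((2 + m) * (1 + m)) + (6 * m + 10) ≡ 3 * ((3 + m) * (2 + m))
  arith = solve-∀

-- With S = 3(m' + 1), the valence 2A/S is at least 3m', while 6g < 9(m' + 2)(m' + 1). The claim
-- reduces to m'² / ((m' + 2)(m' + 1)) ≥ (k / (k + 1))², which is `core`.
valence-lower : ∀ k A g m' → 3 * k < m' → 2 * g < 3 * ((2 + m') * suc m') → suc m' * m' * 3 * 3 ≤ A + A →
  k ^ 2 * (6 * g) * (suc m' * 3) ^ 2 ≤ (2 * A) ^ 2 * suc k ^ 2
valence-lower k A g m' m'-large g-small A-large = begin
  k ^ 2 * (6 * g) * (suc m' * 3) ^ 2 ≡⟨ e₁ k g m' ⟩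
  k * k * (2 * g) * (27 * (suc m' * suc m')) ≤⟨ ℕₚ.*-monoˡ-≤ _ (ℕₚ.*-monoʳ-≤ (k * k) (ℕₚ.<⇒≤ g-small)) ⟩
  k * k * (3 * ((2 + m') * suc m')) * (27 * (suc m' * suc m')) ≡⟨ e₂ k m' ⟩
  81 * (suc m' * suc m') * (k * k * ((2 + m') * suc m')) ≤⟨ ℕₚ.*-monoʳ-≤ (81 * (suc m' * suc m')) core ⟩
  81 * (suc m' * suc m') * (m' * m' * (suc k * suc k)) ≡⟨ e₃ k m' ⟩
  (suc m' * m' * 3 * 3) * (suc m' * m' * 3 * 3) * (suc k * suc k) ≤⟨ ℕₚ.*-monoˡ-≤ (suc k * suc k) (ℕₚ.*-mono-≤ A-large A-large) ⟩
  (A + A) * (A + A) * (suc k * suc k) ≡⟨ e₄ k A ⟩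
  (2 * A) ^ 2 * suc k ^ 2 ∎
  where
  open ℕₚ.≤-Reasoning
  e₁ : ∀ k g m → k * (k * 1) * (6 * g) * ((1 + m) * 3 * ((1 + m) * 3 * 1)) ≡ k * k * (2 * g) * (27 * ((1 + m) * (1 + m)))
  e₁ = solve-∀
  e₂ : ∀ k m → k * k * (3 * ((2 + m) * (1 + m))) * (27 * ((1 + m) * (1 + m)))
    ≡ 81 * ((1 + m) * (1 + m)) * (k * k * ((2 + m) * (1 + m)))
  e₂ = solve-∀
  e₃ : ∀ k m → 81 * ((1 + m) * (1 + m)) * (m * m * ((1 + k) * (1 + k)))
    ≡ ((1 + m) * m * 3 * 3) * ((1 + m) * m * 3 * 3) * ((1 + k) * (1 + k))
  e₃ = solve-∀
  e₄ : ∀ k a → (a + a) * (a + a) * ((1 + k) * (1 + k)) ≡ 2 * a * (2 * a * 1) * ((1 + k) * ((1 + k) * 1))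
  e₄ = solve-∀
  -- Writing m' = 1 + 3k + t, the difference of the two sides of `core` is a polynomial with
  -- nonnegative coefficients.
  e₅ : ∀ k t → k * k * ((2 + (1 + 3 * k + t)) * (1 + (1 + 3 * k + t)))
      + (9 * k * k * k + 7 * k * k + 9 * k * k * t + 2 * k * t * t + 2 * k + 4 * k * t
        + (1 + 3 * k + t) * (1 + 3 * k + t))
    ≡ (1 + 3 * k + t) * (1 + 3 * k + t) * ((1 + k) * (1 + k))
  e₅ = solve-∀
  core : k * k * ((2 + m') * suc m') ≤ m' * m' * (suc k * suc k)
  core with ℕₚ.m≤n⇒∃[o]m+o≡n m'-large
  ... | t , refl = ℕₚ.≤-trans (ℕₚ.m≤m+n _ _) (ℕₚ.≤-reflexive (e₅ k t))

-- The asymptotics are squared and cleared of denominators to stay within ℕ. The first half bounds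
-- the supremum by (1 + 1/(k + 1)) √(6g), the second bounds it below by (1 - 1/(k + 1)) √(6g); as k
-- is arbitrary, the error is o(√g).
theorem1p14 : ∀ (k : ℕ) → ∃ λ N → ∀ (g : ℕ) → N ≤ g →
    ((M : Map) → (S A : ℕ) → Map.CellularGenus M g → Map.HasCompleteLeftWalk M →
    Map.NumVertices M S → Map.ReducedEdges M A →
    (2 * A) ^ 2 * (suc k) ^ 2 ≤ (suc k + 1) ^ 2 * (6 * g) * S ^ 2)
    × (∃ λ (M : Map) → ∃ λ S → ∃ λ A → Map.CellularGenus M g × Map.HasCompleteLeftWalk M
    × Map.NumVertices M S × Map.ReducedEdges M A
    × k ^ 2 * (6 * g) * S ^ 2 ≤ (2 * A) ^ 2 * (suc k) ^ 2)
theorem1p14 k = N₁ + N₂ , λ g N≤g → upper g (ℕₚ.m+n≤o⇒m≤o N₁ N≤g) , lower g (ℕₚ.m+n≤o⇒n≤o N₁ N≤g)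
  where
  N₁ N₂ : ℕ
  -- `N₁` ensures `36 K² ≤ 6g` for K = k + 1, and `N₂` makes the size m' chosen by `boseSize` exceed
  -- 3k.
  N₁ = 6 * (suc k * suc k)
  N₂ = 3 * ((2 + 3 * k) * suc (3 * k))
  upper : ∀ g → N₁ ≤ g → (M : Map) → (S A : ℕ) → Map.CellularGenus M g → Map.HasCompleteLeftWalk M →
    Map.NumVertices M S → Map.ReducedEdges M A →
    (2 * A) ^ 2 * (suc k) ^ 2 ≤ (suc k + 1) ^ 2 * (6 * g) * S ^ 2
  upper g g-large M S A genus complete verts joined = valence-upper (suc k) A S (6 * g)
    (ℕₚ.≤-trans (ℕₚ.≤-reflexive (ℕₚ.*-assoc 6 6 (suc k * suc k))) (ℕₚ.*-monoʳ-≤ 6 g-large))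
    (s≤s z≤n) (2A≤S² M verts joined) (2A≤3S+6g M {g = g} genus complete verts joined)
  lower : ∀ g → N₂ ≤ g → ∃ λ (M : Map) → ∃ λ S → ∃ λ A → Map.CellularGenus M g × Map.HasCompleteLeftWalk M
    × Map.NumVertices M S × Map.ReducedEdges M A
    × k ^ 2 * (6 * g) * S ^ 2 ≤ (2 * A) ^ 2 * (suc k) ^ 2
  lower g g-large =
    let m' , lo , hi = boseSize g
        M , A , genus , complete , verts , joined , A-large = Bose.boseMap m' g lo
    in M , suc m' * 3 , A , genus , complete , verts , joined
      , valence-lower k A g m' (ℕₚ.≰⇒> (m'-large {g} g-large hi)) hi A-large
    where
    m'-large : ∀ {g m'} → N₂ ≤ g → 2 * g < 3 * ((2 + m') * suc m') → ¬ (m' ≤ 3 * k)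
    m'-large {g} N₂≤g hi m'≤ = ℕₚ.<⇒≱ hi (ℕₚ.≤-trans
      (ℕₚ.*-monoʳ-≤ 3 (ℕₚ.*-mono-≤ (ℕₚ.+-monoʳ-≤ 2 m'≤) (s≤s m'≤)))
      (ℕₚ.≤-trans N₂≤g (ℕₚ.m≤m+n g (g + 0))))
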